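{- Let $q$ be a prime power and let $t$ be a positive integer with $t < q$. Then, with $q$ and $t$ fixed and $n \to \infty$, $$\mathrm{M}_t(n,q) = \Omega\left(q^{\,n\left(1-\frac{2}{t^2+t}\right)}\right),$$ where $\mathrm{M}_t(n,q)$ denotes the maximum size of a $t$-line evasive subset of $\mathbb{F}_q^n$.
   Context: $\mathbb{F}_q$ is the finite field with $q$ elements and $\mathbb{F}_q^n$ is regarded as the affine space $\mathrm{AG}(n,q)$. An affine line in $\mathbb{F}_q^n$ is a set $\{ax+b : x \in \mathbb{F}_q\}$ with $a,b\in\mathbb{F}_q^n$, $a \neq 0$. A subset $K \subseteq \mathbb{F}_q^n$ is called $t$-line evasive if every affine line of $\mathbb{F}_q^n$ intersects $K$ in at most $t$ points. -}

module Defs where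

open import Level using (0ℓ)
open import Data.Nat as ℕ using (ℕ; suc)
open import Data.List using (List; length; filter)
open import Data.List.Membership.Propositional using (_∈_)
open import Data.List.Relation.Unary.Unique.Propositional using (Unique)
open import Data.Vec using (Vec; replicate; zipWith; map)
open import Data.Product using (Σ; ∃; _×_; _,_)
open import Relation.Nullary using (¬_; Dec)
open import Relation.Binary.PropositionalEquality using (_≡_)
open import Relation.Binary using (DecidableEquality)
open import Algebra.Structures using (IsCommutativeRing)

record FiniteField : Set₁ where
  field
    Carrier : Set
    _+_ _*_ : Carrier → Carrier → Carrier
    -_      : Carrier → Carrier
    0# 1#   : Carrier
    isCommutativeRing : IsCommutativeRing _≡_ _+_ _*_ -_ 0# 1#
    0≢1     : ¬ (0# ≡ 1#)
    inverse : ∀ x → ¬ (x ≡ 0#) → Σ Carrier λ y → x * y ≡ 1#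
    _≟_     : DecidableEquality Carrier
    elements : List Carrier
    elements-unique   : Unique elements
    elements-complete : ∀ x → x ∈ elements

  order : ℕ
  order = length elements

module _ (F : FiniteField) where
  open FiniteField F

  Point : ℕ → Set
  Point n = Vec Carrier n

  zeroVec : ∀ n → Point n
  zeroVec n = replicate n 0#

  linePoint : ∀ {n} → Point n → Point n → Carrier → Point n
  linePoint a b x = zipWith _+_ (map (x *_) a) b

  _≟ᵥ_ : ∀ {n} → DecidableEquality (Point n)
  _≟ᵥ_ = Data.Vec.Properties.≡-dec _≟_
    where import Data.Vec.Properties

  _∈?_ : ∀ {n} (p : Point n) (K : List (Point n)) → Dec (p ∈ K)
  p ∈? K = Data.List.Membership.DecPropositional._∈?_ _≟ᵥ_ p K
    where import Data.List.Membership.DecPropositional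

  -- |ℓ ∩ K| for the line ℓ = {a x + b : x ∈ F}, a ≠ 0
  -- (distinct x give distinct points since a ≠ 0)
  lineIntersectionSize : ∀ {n} → Point n → Point n → List (Point n) → ℕ
  lineIntersectionSize a b K = length (filter (λ x → linePoint a b x ∈? K) elements)

  -- a finite subset K of F^n (a duplicate-free list) is t-line evasive
  LineEvasive : ∀ {n} → ℕ → List (Point n) → Set
  LineEvasive {n} t K = ∀ (a b : Point n) → ¬ (a ≡ zeroVec n) →
    lineIntersectionSize a b K ℕ.≤ t

{-# OPTIONS --safe #-}
-- Put s = 1 + 2 + ⋯ + t = (t² + t)/2 and split 𝔽_q^s into blocks x₁, …, x_t with x_i ∈ 𝔽_q^i ≅ 𝔽_{q^i}.
-- Let H(x) = x₁ + N₂(x₂) + ⋯ + N_t(x_t), where N_i is the norm form of 𝔽_{q^i}/𝔽_q: it has degree i and no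
-- nontrivial zero.  Along a line with direction a, H is a polynomial of degree exactly max {i : a_i ≠ 0} ≤ t,
-- so {H = 0} is t-line evasive; being the graph of a function of the last s − 1 coordinates, it has q^(s−1)
-- points.  Products of t-line evasive sets are t-line evasive (project the line to a factor where it does not
-- degenerate), so taking ⌊n/s⌋ copies of {H = 0} and n mod s single points gives the bound.
--
-- The norm is taken in 𝔽_q[X]/(P), where X has exact period i under Frobenius; then 𝔽_q^i is identified with the
-- polynomials of degree < i and N(A) = A · A^q ⋯ A^(q^(i−1)).  Such a P exists since X^(q^i) − X is square-free
-- of larger degree than the product of all X^(q^d) − X with 1 ≤ d < i.  The degree of P plays no further role.
module Submission where

open import Defs
open import Algebra using (CommutativeRing; CommutativeMonoid)
open import Algebra.Structures using (IsCommutativeMonoid; IsAbelianGroup)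
open import Algebra.Morphism.Structures using (IsRingHomomorphism)
open import Algebra.Solver.Ring.AlmostCommutativeRing using (fromCommutativeRing; _-Raw-AlmostCommutative⟶_)
import Algebra.Solver.Ring
open import Data.Empty using (⊥-elim)
open import Data.Integer as ℤ using (ℤ; +_; -[1+_]; _⊖_; 0ℤ; 1ℤ)
import Data.Integer.Properties as ℤ
open import Data.List as List using (List; []; _∷_; length)
import Data.List.Properties as List
open import Data.List.Membership.Propositional using (_∈_)
import Data.List.Membership.Propositional.Properties as ∈
open import Data.List.Membership.Propositional.Properties.WithK using (unique∧set⇒bag)
open import Data.List.Relation.Binary.BagAndSetEquality using (∼bag⇒↭)
open import Data.List.Relation.Binary.Permutation.Propositional using (↭⇒↭ₛ)
open import Data.List.Relation.Binary.Permutation.Propositional.Properties using (↭-length)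
open import Data.List.Relation.Binary.Permutation.Setoid.Properties using (foldr-commMonoid)
open import Data.List.Relation.Binary.Sublist.Propositional using (⊆-refl)
open import Data.List.Relation.Binary.Sublist.Propositional.Properties using (filter⁺; length-mono-≤)
open import Data.List.Relation.Unary.All as All using (All; []; _∷_)
import Data.List.Relation.Unary.All.Properties as All
open import Data.List.Relation.Unary.Any using (here; there)
open import Data.List.Relation.Unary.AllPairs as AllPairs using (AllPairs; []; _∷_)
import Data.List.Relation.Unary.AllPairs.Properties as AllPairs
open import Data.List.Relation.Unary.Unique.Propositional using (Unique)
import Data.List.Relation.Unary.Unique.Propositional.Properties as Unique
open import Data.Maybe using (Maybe; just; nothing)
open import Data.Nat as ℕ using (ℕ; zero; suc; z≤n; s≤s)
open import Data.Nat.Induction using (<-rec)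
import Data.Nat.Properties as ℕ
open import Data.Nat.DivMod using (_/_; _%_; m≡m%n+[m/n]*n; m%n≤n)
open import Data.Nat.Solver using (module +-*-Solver)
open import Data.Product using (Σ; ∃; ∃₂; _×_; _,_; proj₁; proj₂)
open import Data.Sign as Sign using (Sign)
open import Data.Sum using (_⊎_; inj₁; inj₂)
open import Data.Vec as Vec using (Vec; []; _∷_)
import Data.Vec.Properties as Vec
open import Function using (_∘_; mk⇔; id)
open import Level using (0ℓ)
open import Relation.Binary.PropositionalEquality as ≡ using (_≡_; _≢_)
open import Relation.Nullary using (¬_; ¬?; Dec; yes; no)
import Algebra.Properties.Semiring.Exp
import Algebra.Properties.Semiring.Mult

-- The obstacle is to obtain norm forms of every degree i with 2 ≤ i ≤ t when F is known only by its
-- operations and a list of its elements: neither a characteristic nor a prime power is given.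
-- Counting supplies two facts in their place, `order·1≡0`, by which q-th powers have derivative 0,
-- and `fermat`, by which y^q - y splits over F. The exact period of X does the work of the degree
-- of P. It makes X, X^q, ..., X^(q^(i-1)) distinct, so a nonzero polynomial of degree < i, which
-- cannot have them all as roots, is nonzero mod P. This injectivity is all that the identification
-- of F^i requires, and no dimension of F[X]/(P) is computed. Periodicity itself makes every element
-- fixed by the i-th Frobenius iterate, so norms land in F. The exponent 1 - 2/(t² + t) is (s -
-- 1)/s: a graph with q^(s-1) points in dimension s.

-- Normalisation in commutative rings with integer coefficients

-- Equality in R is undecidable, so the solver can cancel coefficients only if these are integers.
module IntegerSolver (R : CommutativeRing 0ℓ 0ℓ) where
  open CommutativeRing R
  open import Algebra.Properties.Ring ring
  open import Algebra.Properties.Semiring.Mult.TCOptimised semiring using (×-homo-+; ×1-homo-*; 1+×) renaming (_×_ to _·_)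
  open import Algebra.Properties.CommutativeSemigroup +-commutativeSemigroup using (interchange)
  open import Relation.Binary.Reasoning.Setoid setoid

  ⟦_⟧ℤ : ℤ → Carrier
  ⟦ + n ⟧ℤ      = n · 1#
  ⟦ -[1+ n ] ⟧ℤ = - (suc n · 1#)

  ⊖-homo : ∀ m n → ⟦ m ⊖ n ⟧ℤ ≈ m · 1# - n · 1#
  ⊖-homo zero    zero    = sym (-‿inverseʳ 0#)
  ⊖-homo zero    (suc n) = sym (+-identityˡ _)
  ⊖-homo (suc m) zero    = sym (trans (+-congˡ -0#≈0#) (+-identityʳ _))
  ⊖-homo (suc m) (suc n) = begin
    ⟦ suc m ⊖ suc n ⟧ℤ                 ≡⟨ ≡.cong ⟦_⟧ℤ (ℤ.[1+m]⊖[1+n]≡m⊖n m n) ⟩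
    ⟦ m ⊖ n ⟧ℤ                         ≈⟨ ⊖-homo m n ⟩
    m · 1# - n · 1#                    ≈⟨ +-identityˡ _ ⟨
    0# + (m · 1# - n · 1#)             ≈⟨ +-congʳ (-‿inverseʳ 1#) ⟨
    (1# - 1#) + (m · 1# - n · 1#)      ≈⟨ interchange 1# (- 1#) (m · 1#) (- (n · 1#)) ⟩
    (1# + m · 1#) + (- 1# - n · 1#)    ≈⟨ +-congˡ (-‿+-comm 1# (n · 1#)) ⟩
    (1# + m · 1#) - (1# + n · 1#)      ≈⟨ +-cong (1+× m 1#) (-‿cong (1+× n 1#)) ⟨
    suc m · 1# - suc n · 1#            ∎

  +-homo : ∀ i j → ⟦ i ℤ.+ j ⟧ℤ ≈ ⟦ i ⟧ℤ + ⟦ j ⟧ℤ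
  +-homo (+ m)    (+ n)    = ×-homo-+ 1# m n
  +-homo (+ m)    -[1+ n ] = ⊖-homo m (suc n)
  +-homo -[1+ m ] (+ n)    = trans (⊖-homo n (suc m)) (+-comm _ _)
  +-homo -[1+ m ] -[1+ n ] = begin
    - (suc (suc (m ℕ.+ n)) · 1#)       ≡⟨ ≡.cong (λ k → - (suc k · 1#)) (ℕ.+-suc m n) ⟨
    - ((suc m ℕ.+ suc n) · 1#)         ≈⟨ -‿cong (×-homo-+ 1# (suc m) (suc n)) ⟩
    - (suc m · 1# + suc n · 1#)        ≈⟨ -‿+-comm (suc m · 1#) (suc n · 1#) ⟨
    - (suc m · 1#) - (suc n · 1#)      ∎

  -‿homo : ∀ i → ⟦ ℤ.- i ⟧ℤ ≈ - ⟦ i ⟧ℤ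
  -‿homo (+ zero)  = sym -0#≈0#
  -‿homo (+ suc n) = CommutativeRing.refl R
  -‿homo -[1+ n ]  = sym (-‿involutive _)

  -◃-homo : ∀ n → ⟦ Sign.- ℤ.◃ n ⟧ℤ ≈ - (n · 1#)
  -◃-homo zero    = sym -0#≈0#
  -◃-homo (suc n) = CommutativeRing.refl R

  +◃-homo : ∀ n → ⟦ Sign.+ ℤ.◃ n ⟧ℤ ≈ n · 1#
  +◃-homo zero    = CommutativeRing.refl R
  +◃-homo (suc n) = CommutativeRing.refl R

  *-homo : ∀ i j → ⟦ i ℤ.* j ⟧ℤ ≈ ⟦ i ⟧ℤ * ⟦ j ⟧ℤ
  *-homo (+ m)    (+ n)    = trans (+◃-homo (m ℕ.* n)) (×1-homo-* m n)
  *-homo (+ m)    -[1+ n ] = begin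
    ⟦ Sign.- ℤ.◃ (m ℕ.* suc n) ⟧ℤ   ≈⟨ -◃-homo (m ℕ.* suc n) ⟩
    - ((m ℕ.* suc n) · 1#)          ≈⟨ -‿cong (×1-homo-* m (suc n)) ⟩
    - (m · 1# * suc n · 1#)         ≈⟨ -‿distribʳ-* _ _ ⟩
    m · 1# * - (suc n · 1#)         ∎
  *-homo -[1+ m ] (+ n)    = begin
    ⟦ Sign.- ℤ.◃ (suc m ℕ.* n) ⟧ℤ   ≈⟨ -◃-homo (suc m ℕ.* n) ⟩
    - ((suc m ℕ.* n) · 1#)          ≈⟨ -‿cong (×1-homo-* (suc m) n) ⟩
    - (suc m · 1# * n · 1#)         ≈⟨ -‿distribˡ-* _ _ ⟩
    - (suc m · 1#) * n · 1#         ∎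
  *-homo -[1+ m ] -[1+ n ] = trans (×1-homo-* (suc m) (suc n)) (sym (-x*-y≈xy _ _))
    where
    -x*-y≈xy : ∀ x y → - x * - y ≈ x * y
    -x*-y≈xy x y = begin
      - x * - y     ≈⟨ -‿distribˡ-* x (- y) ⟨
      - (x * - y)   ≈⟨ -‿cong (-‿distribʳ-* x y) ⟨
      - (- (x * y)) ≈⟨ -‿involutive _ ⟩
      x * y         ∎

  morphism : ℤ.+-*-rawRing -Raw-AlmostCommutative⟶ fromCommutativeRing R
  morphism = record
    { ⟦_⟧ = ⟦_⟧ℤ ; +-homo = +-homo ; *-homo = *-homo ; -‿homo = -‿homo
    ; 0-homo = CommutativeRing.refl R ; 1-homo = CommutativeRing.refl R }

  -- Distinct integers can have equal images in `R`, so this decides in one direction only;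
  -- `nothing` leaves a coefficient uncancelled.
  coefficientDec : (i j : ℤ) → Maybe (⟦ i ⟧ℤ ≈ ⟦ j ⟧ℤ)
  coefficientDec i j with i ℤ.≟ j
  ... | yes ≡.refl = just (CommutativeRing.refl R)
  ... | no _     = nothing

  open Algebra.Solver.Ring ℤ.+-*-rawRing (fromCommutativeRing R) morphism coefficientDec public
    using (solve; _:=_; _:+_; _:*_; _:-_; :-_; con)

-- Polynomial functions over a commutative ring and their roots

module PolynomialFunctions (R : CommutativeRing 0ℓ 0ℓ) where
  open CommutativeRing R
  open IntegerSolver R
  open import Algebra.Properties.Semiring.Exp semiring using (_^_)
  open import Relation.Binary.Reasoning.Setoid setoid

  -- u is the coefficient of y^d and may vanish: IsPoly 0# d f says that f has degree less than d.
  data IsPoly (u : Carrier) : ℕ → (Carrier → Carrier) → Set where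
    constant : ∀ {f} → (∀ y → f y ≈ u) → IsPoly u 0 f
    horner   : ∀ {d f} g b → IsPoly u d g → (∀ y → f y ≈ y * g y + b) → IsPoly u (suc d) f

  isPoly-cong : ∀ {u v d f g} → u ≈ v → (∀ y → f y ≈ g y) → IsPoly u d f → IsPoly v d g
  isPoly-cong u≈v f≗g (constant e)     = constant λ y → trans (sym (f≗g y)) (trans (e y) u≈v)
  isPoly-cong u≈v f≗g (horner h b p e) =
    horner h b (isPoly-cong u≈v (λ _ → refl) p) λ y → trans (sym (f≗g y)) (e y)

  isPoly-+ : ∀ {u v d f g} → IsPoly u d f → IsPoly v d g → IsPoly (u + v) d (λ y → f y + g y)
  isPoly-+ (constant e)     (constant e′)     = constant λ y → +-cong (e y) (e′ y)
  isPoly-+ (horner f b p e) (horner g c q e′) =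
    horner (λ y → f y + g y) (b + c) (isPoly-+ p q) λ y → trans (+-cong (e y) (e′ y))
      (solve 5 (λ y f b g c → y :* f :+ b :+ (y :* g :+ c) := y :* (f :+ g) :+ (b :+ c)) refl y (f y) b (g y) c)

  isPoly-* : ∀ {u d f} a → IsPoly u d f → IsPoly (a * u) d (λ y → a * f y)
  isPoly-* a (constant e)     = constant λ y → *-congˡ (e y)
  isPoly-* a (horner f b p e) =
    horner (λ y → a * f y) (a * b) (isPoly-* a p) λ y → trans (*-congˡ (e y))
      (solve 4 (λ y f b a → a :* (y :* f :+ b) := y :* (a :* f) :+ a :* b) refl y (f y) b a)

  isPoly-raise : ∀ {u d f} → IsPoly u d f → IsPoly 0# (suc d) f
  isPoly-raise {u} (constant e) = horner (λ _ → 0#) u (constant λ _ → refl)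
    λ y → trans (e y) (sym (trans (+-congʳ (zeroʳ y)) (+-identityˡ u)))
  isPoly-raise (horner g b p e) = horner g b (isPoly-raise p) e

  isPoly-lift : ∀ {u d e f} → d ℕ.< e → IsPoly u d f → IsPoly 0# e f
  isPoly-lift d<e p = go (ℕ.≤⇒≤′ d<e) p
    where
    go : ∀ {u d e f} → suc d ℕ.≤′ e → IsPoly u d f → IsPoly 0# e f
    go ℕ.≤′-refl     p = isPoly-raise p
    go (ℕ.≤′-step l) p = isPoly-raise (go l p)

  isPoly-linear : ∀ {u d f} a b → IsPoly u d f → IsPoly (a * u) (suc d) (λ y → (y * a + b) * f y)
  isPoly-linear {f = f} a b p = isPoly-cong (+-identityʳ _)
    (λ y → solve 4 (λ y a b f → y :* (a :* f) :+ con 0ℤ :+ b :* f := (y :* a :+ b) :* f) refl y a b (f y))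
    (isPoly-+ (horner (λ y → a * f y) 0# (isPoly-* a p) λ _ → refl) (isPoly-raise (isPoly-* b p)))

  isPoly-id : IsPoly 1# 1 id
  isPoly-id = horner (λ _ → 1#) 0# (constant λ _ → refl) λ y → sym (trans (+-identityʳ _) (*-identityʳ y))

  isPoly-^ : ∀ b n → IsPoly 1# n (λ y → (y + b) ^ n)
  isPoly-^ b zero    = constant λ _ → refl
  isPoly-^ b (suc n) = isPoly-cong (*-identityˡ 1#) (λ y → *-congʳ (+-congʳ (*-identityʳ y)))
    (isPoly-linear 1# b (isPoly-^ b n))

  -- Synthetic division: `y - c` is monic, so it works over any commutative ring and keeps the
  -- leading coefficient.
  isPoly-factor : ∀ {u d f} c → IsPoly u (suc d) f →
                  ∃ λ h → IsPoly u d h × (∀ y → f y ≈ (y - c) * h y + f c)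
  isPoly-factor {u} {f = f} c (horner g b (constant e′) e) = g , constant e′ , λ y → begin
    f y                           ≈⟨ e y ⟩
    y * g y + b                   ≈⟨ solve 4 (λ y c g b → y :* g :+ b := (y :- c) :* g :+ (c :* g :+ b)) refl y c (g y) b ⟩
    (y - c) * g y + (c * g y + b) ≈⟨ +-congˡ (+-congʳ (*-congˡ (trans (e′ y) (sym (e′ c))))) ⟩
    (y - c) * g y + (c * g c + b) ≈⟨ +-congˡ (e c) ⟨
    (y - c) * g y + f c           ∎
  isPoly-factor {f = f} c (horner g b p@(horner _ _ _ _) e) with isPoly-factor c p
  -- From `g y ≈ (y - c) * k y + g c` it follows that `y * g y - c * g c` equals
  -- `(y - c) * (g y + c * k y)`. The summand `c * k y` has lower degree and leaves the leading
  -- coefficient alone.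
  ... | k , q , e′ = (λ y → g y + c * k y) ,
    isPoly-cong (+-identityʳ _) (λ _ → refl) (isPoly-+ p (isPoly-raise (isPoly-* c q))) , λ y → begin
    f y                                                             ≈⟨ e y ⟩
    y * g y + b                                                     ≈⟨ +-congʳ (*-congˡ (e′ y)) ⟩
    y * ((y - c) * k y + g c) + b                                   ≈⟨ solve 5 (λ y c k g b → y :* ((y :- c) :* k :+ g) :+ b := (y :- c) :* (((y :- c) :* k :+ g) :+ c :* k) :+ (c :* g :+ b)) refl y c (k y) (g c) b ⟩
    (y - c) * (((y - c) * k y + g c) + c * k y) + (c * g c + b)     ≈⟨ +-cong (*-congˡ (+-congʳ (e′ y))) (e c) ⟨
    (y - c) * (g y + c * k y) + f c                                 ∎

  -- The right notion of distinct points when R has zero divisors.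
  Separated : Carrier → Carrier → Set
  Separated c c′ = ∀ z → (c′ - c) * z ≈ 0# → z ≈ 0#

  -- Removing one root keeps the others: at a root `c′` the factor `c′ - c` cancels, which is what
  -- `Separated` grants.
  isPoly-deflate : ∀ {u d f} c → IsPoly u (suc d) f → f c ≈ 0# →
                   ∃ λ h → IsPoly u d h × (∀ y → f y ≈ (y - c) * h y) ×
                           (∀ {c′} → Separated c c′ → f c′ ≈ 0# → h c′ ≈ 0#)
  isPoly-deflate {f = f} c p root with isPoly-factor c p
  ... | h , q , e = h , q , e′ , λ sep root′ → sep _ (trans (sym (e′ _)) root′)
    where
    e′ : ∀ y → f y ≈ (y - c) * h y
    e′ y = trans (e y) (trans (+-congˡ root) (+-identityʳ _))

  rootProduct : List Carrier → Carrier → Carrier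
  rootProduct cs y = List.foldr (λ c z → (y - c) * z) 1# cs

  -- Deflation by as many roots as the degree runs down to the constant `u`. With `u ≈ 0#` this is
  -- an identity theorem, with `u ≈ 1#` a factorisation.
  isPoly-split : ∀ {u f} cs → IsPoly u (length cs) f → AllPairs Separated cs →
                 All (λ c → f c ≈ 0#) cs → ∀ y → f y ≈ u * rootProduct cs y
  isPoly-split []       (constant e) _ _ y = trans (e y) (sym (*-identityʳ _))
  isPoly-split {u} (c ∷ cs) p (s ∷ ss) (r ∷ rs) y with isPoly-deflate c p r
  ... | h , q , e , roots = trans (e y) (trans
      (*-congˡ (isPoly-split cs q ss (All.zipWith (λ (s′ , r′) → roots s′ r′) (s , rs)) y))
      (solve 3 (λ w u z → w :* (u :* z) := u :* (w :* z)) refl (y - c) u (rootProduct cs y)))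

  -- A root beyond the degree survives deflation down to the constant `u`. The conclusion is an
  -- equation rather than a contradiction, so equality in the ring need not be decided.
  tooManyRoots⇒lead≈0 : ∀ {u d f} cs → d ℕ.< length cs → IsPoly u d f → AllPairs Separated cs →
                        All (λ c → f c ≈ 0#) cs → u ≈ 0#
  tooManyRoots⇒lead≈0 (c ∷ cs) _ (constant e) _ (r ∷ _) = trans (sym (e c)) r
  tooManyRoots⇒lead≈0 (c ∷ cs) (s≤s l) p@(horner _ _ _ _) (s ∷ ss) (r ∷ rs) with isPoly-deflate c p r
  ... | h , q , e , roots =
    tooManyRoots⇒lead≈0 cs l q ss (All.zipWith (λ (s′ , r′) → roots s′ r′) (s , rs))

-- Counting and translation in finite lists

length-cartesianProductWith : {A B C : Set} (f : A → B → C) (xs : List A) (ys : List B) →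
                              length (List.cartesianProductWith f xs ys) ≡ length xs ℕ.* length ys
length-cartesianProductWith f []       ys = ≡.refl
length-cartesianProductWith f (x ∷ xs) ys = ≡.trans (List.length-++ (List.map (f x) ys))
  (≡.cong₂ ℕ._+_ (List.length-map (f x) ys) (length-cartesianProductWith f xs ys))

module _ {A : Set} {_∙_ : A → A → A} {ε : A} (isCommutativeMonoid : IsCommutativeMonoid _≡_ _∙_ ε) where
  private
    monoid : CommutativeMonoid 0ℓ 0ℓ
    monoid = record { isCommutativeMonoid = isCommutativeMonoid }

  open CommutativeMonoid monoid using (identityˡ; commutativeSemigroup; rawMonoid)
  open import Algebra.Properties.CommutativeSemigroup commutativeSemigroup using (interchange)
  open import Algebra.Definitions.RawMonoid rawMonoid renaming (_×_ to _·_)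

  fold-map-∙ : ∀ a xs → List.foldr _∙_ ε (List.map (a ∙_) xs) ≡ (length xs · a) ∙ List.foldr _∙_ ε xs
  fold-map-∙ a []       = ≡.sym (identityˡ ε)
  fold-map-∙ a (x ∷ xs) = ≡.trans (≡.cong ((a ∙ x) ∙_) (fold-map-∙ a xs)) (interchange a x _ _)

  -- Translation by a permutes xs.
  fold-translate : ∀ {xs} a → Unique xs → (∀ {x y} → a ∙ x ≡ a ∙ y → x ≡ y) →
                   (∀ {x} → x ∈ xs → a ∙ x ∈ xs) → (∀ {x} → x ∈ xs → ∃ λ y → y ∈ xs × x ≡ a ∙ y) →
                   (length xs · a) ∙ List.foldr _∙_ ε xs ≡ List.foldr _∙_ ε xs
  fold-translate {xs} a unique inj closed onto = ≡.trans (≡.sym (fold-map-∙ a xs))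
    (foldr-commMonoid (≡.setoid A) isCommutativeMonoid (↭⇒↭ₛ (∼bag⇒↭
      (unique∧set⇒bag (Unique.map⁺ inj unique) unique (mk⇔ to (from ∘ onto))))))
    where
    to : ∀ {x} → x ∈ List.map (a ∙_) xs → x ∈ xs
    to x∈ with ∈.∈-map⁻ (a ∙_) x∈
    ... | y , y∈ , ≡.refl = closed y∈
    from : ∀ {x} → (∃ λ y → y ∈ xs × x ≡ a ∙ y) → x ∈ List.map (a ∙_) xs
    from (y , y∈ , ≡.refl) = ∈.∈-map⁺ (a ∙_) y∈

-- The finite field `F`: Fermat's identity and the list of vectors

module FieldProperties (F : FiniteField) where
  open FiniteField F using (0≢1; inverse; _≟_; elements; elements-unique; elements-complete; order)

  fieldRing : CommutativeRing 0ℓ 0ℓ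
  fieldRing = record { isCommutativeRing = FiniteField.isCommutativeRing F }

  open CommutativeRing fieldRing
  open IntegerSolver fieldRing
  open PolynomialFunctions fieldRing using (Separated)
  open import Algebra.Properties.Semiring.Exp semiring using (_^_)
  open import Algebra.Properties.Semiring.Mult semiring using () renaming (_×_ to _·_)
  open import Algebra.Properties.Ring ring
  open ≡.≡-Reasoning

  nonzero-cancel : ∀ {a b} → a ≢ 0# → a * b ≡ 0# → b ≡ 0#
  nonzero-cancel {a} {b} a≢0 ab≡0 with inverse a a≢0
  ... | a⁻¹ , aa⁻¹≡1 = begin
    b               ≡⟨ *-identityˡ b ⟨
    1# * b          ≡⟨ ≡.cong (_* b) aa⁻¹≡1 ⟨
    (a * a⁻¹) * b   ≡⟨ solve 3 (λ a a⁻¹ b → (a :* a⁻¹) :* b := a⁻¹ :* (a :* b)) ≡.refl a a⁻¹ b ⟩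
    a⁻¹ * (a * b)   ≡⟨ ≡.cong (a⁻¹ *_) ab≡0 ⟩
    a⁻¹ * 0#        ≡⟨ zeroʳ a⁻¹ ⟩
    0#              ∎

  *-nonzero : ∀ {a b} → a ≢ 0# → b ≢ 0# → a * b ≢ 0#
  *-nonzero a≢0 b≢0 ab≡0 = b≢0 (nonzero-cancel a≢0 ab≡0)

  *-cancelˡ-nonzero : ∀ {a b c} → a ≢ 0# → a * b ≡ a * c → b ≡ c
  *-cancelˡ-nonzero {a} {b} {c} a≢0 ab≡ac = x∙y⁻¹≈ε⇒x≈y b c (nonzero-cancel a≢0
    (≡.trans (x[y-z]≈xy-xz a b c) (x≈y⇒x∙y⁻¹≈ε ab≡ac)))

  distinct⇒separated : ∀ {c c′} → c ≢ c′ → Separated c c′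
  distinct⇒separated {c} {c′} c≢c′ z =
    nonzero-cancel (λ c′-c≡0 → c≢c′ (≡.sym (x∙y⁻¹≈ε⇒x≈y c′ c c′-c≡0)))

  -- Adding 1 permutes F, so the sum of all elements absorbs `order · 1#`. This will make the
  -- derivatives of q-th powers vanish.
  order·1≡0 : order · 1# ≡ 0#
  order·1≡0 = +-cancelʳ total (order · 1#) 0# (≡.trans
    (fold-translate +-isCommutativeMonoid 1# elements-unique (+-cancelˡ 1# _ _)
      (λ _ → elements-complete _)
      (λ {x} _ → x - 1# , elements-complete _ , solve 2 (λ x e → x := e :+ (x :- e)) ≡.refl x 1#))
    (≡.sym (+-identityˡ total)))
    where
    total = List.foldr _+_ 0# elements

  private
    nonzeros : List Carrier
    nonzeros = List.filter (λ x → ¬? (x ≟ 0#)) elements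

    nonzeros-unique : Unique nonzeros
    nonzeros-unique = Unique.filter⁺ (λ x → ¬? (x ≟ 0#)) elements-unique

    ∈nonzeros : ∀ {x} → x ≢ 0# → x ∈ nonzeros
    ∈nonzeros x≢0 = ∈.∈-filter⁺ (λ x → ¬? (x ≟ 0#)) (elements-complete _) x≢0

    ∈nonzeros⁻ : ∀ {x} → x ∈ nonzeros → x ≢ 0#
    ∈nonzeros⁻ x∈ = proj₂ (∈.∈-filter⁻ (λ x → ¬? (x ≟ 0#)) {xs = elements} x∈)

    length-nonzeros : suc (length nonzeros) ≡ order
    length-nonzeros = ↭-length (∼bag⇒↭ (unique∧set⇒bag
      (All.tabulate (λ x∈ 0≡x → ∈nonzeros⁻ x∈ (≡.sym 0≡x)) ∷ nonzeros-unique) elements-unique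
      (mk⇔ (λ _ → elements-complete _) (λ _ → from _))))
      where
      from : ∀ x → x ∈ 0# ∷ nonzeros
      from x with x ≟ 0#
      ... | yes x≡0 = here x≡0
      ... | no  x≢0 = there (∈nonzeros x≢0)

    -- The multiplicative counterpart: `x` permutes the nonzero elements, whose product is nonzero
    -- and therefore cancels.
    ^-length-nonzeros : ∀ {x} → x ≢ 0# → x ^ length nonzeros ≡ 1#
    ^-length-nonzeros {x} x≢0 = *-cancelˡ-nonzero total-nonzero (begin
      total * x ^ length nonzeros   ≡⟨ *-comm total _ ⟩
      x ^ length nonzeros * total   ≡⟨ fold-translate *-isCommutativeMonoid x nonzeros-unique
                                         (*-cancelˡ-nonzero x≢0)
                                         (λ y∈ → ∈nonzeros (*-nonzero x≢0 (∈nonzeros⁻ y∈))) onto ⟩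
      total                         ≡⟨ *-identityʳ total ⟨
      total * 1#                    ∎)
      where
      x⁻¹ = proj₁ (inverse x x≢0)
      xx⁻¹≡1 = proj₂ (inverse x x≢0)
      total = List.foldr _*_ 1# nonzeros
      total-nonzero : total ≢ 0#
      total-nonzero = List.foldr-preservesᵇ {P = _≢ 0#} *-nonzero (0≢1 ∘ ≡.sym) (All.tabulate ∈nonzeros⁻)
      onto : ∀ {y} → y ∈ nonzeros → ∃ λ z → z ∈ nonzeros × y ≡ x * z
      onto {y} y∈ = x⁻¹ * y , ∈nonzeros (*-nonzero x⁻¹≢0 (∈nonzeros⁻ y∈)) , (begin
        y                ≡⟨ *-identityˡ y ⟨
        1# * y           ≡⟨ ≡.cong (_* y) xx⁻¹≡1 ⟨
        (x * x⁻¹) * y    ≡⟨ *-assoc x x⁻¹ y ⟩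
        x * (x⁻¹ * y)    ∎)
        where
        x⁻¹≢0 : x⁻¹ ≢ 0#
        x⁻¹≢0 x⁻¹≡0 = 0≢1 (≡.trans (≡.sym (zeroʳ x)) (≡.trans (≡.cong (x *_) (≡.sym x⁻¹≡0)) xx⁻¹≡1))

  fermat : ∀ x → x ^ order ≡ x
  fermat x = ≡.trans (≡.cong (x ^_) (≡.sym length-nonzeros)) (helper (x ≟ 0#))
    where
    helper : Dec (x ≡ 0#) → x * x ^ length nonzeros ≡ x
    helper (yes ≡.refl) = zeroˡ _
    helper (no x≢0)     = ≡.trans (≡.cong (x *_) (^-length-nonzeros x≢0)) (*-identityʳ x)

  2≤order : 2 ℕ.≤ order
  2≤order with elements | elements-complete 0# | elements-complete 1#
  ... | _ ∷ []    | here 0≡x | here 1≡x = ⊥-elim (0≢1 (≡.trans 0≡x (≡.sym 1≡x)))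
  ... | _ ∷ _ ∷ _ | _        | _        = s≤s (s≤s z≤n)

  instance
    order-nonZero : ℕ.NonZero order
    order-nonZero = ℕ.>-nonZero (ℕ.<-≤-trans (s≤s z≤n) 2≤order)

  vectors : ∀ n → List (Vec Carrier n)
  vectors zero    = [] ∷ []
  vectors (suc n) = List.cartesianProductWith _∷_ elements (vectors n)

  vectors-complete : ∀ {n} (v : Vec Carrier n) → v ∈ vectors n
  vectors-complete []      = here ≡.refl
  vectors-complete (x ∷ v) = ∈.∈-cartesianProductWith⁺ _∷_ (elements-complete x) (vectors-complete v)

  vectors-unique : ∀ n → Unique (vectors n)
  vectors-unique zero    = [] ∷ []
  vectors-unique (suc n) = Unique.cartesianProductWith⁺ _∷_ Vec.∷-injective elements-unique (vectors-unique n)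

  length-vectors : ∀ n → length (vectors n) ≡ order ℕ.^ n
  length-vectors zero    = ≡.refl
  length-vectors (suc n) = ≡.trans (length-cartesianProductWith _∷_ elements (vectors n))
    (≡.cong (order ℕ.*_) (length-vectors n))

-- Frobenius and norms in an `F`-algebra `R`, later F[X] and F[X]/(P)

module Frobenius (F : FiniteField) (R : CommutativeRing 0ℓ 0ℓ)
  (ι : FiniteField.Carrier F → CommutativeRing.Carrier R)
  (ι-isRingHomomorphism : IsRingHomomorphism (CommutativeRing.rawRing (FieldProperties.fieldRing F))
                                             (CommutativeRing.rawRing R) ι)
  where
  open FiniteField F using (inverse; elements; elements-unique; order)
    renaming (Carrier to K)
  open FieldProperties F
  private module K = CommutativeRing fieldRing
  open import Algebra.Properties.Semiring.Exp K.semiring using () renaming (_^_ to _^ₖ_)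
  open import Algebra.Properties.Ring K.ring using () renaming (x∙y⁻¹≈ε⇒x≈y to x-y≡0⇒x≡y)
  open CommutativeRing R
  open IntegerSolver R
  open PolynomialFunctions R
  open IsRingHomomorphism ι-isRingHomomorphism public
    using () renaming (+-homo to ι-+; *-homo to ι-*; 1#-homo to ι-1; 0#-homo to ι-0; -‿homo to ι--)
  open import Algebra.Properties.CommutativeSemiring.Exp commutativeSemiring using (_^_; ^-congˡ; ^-distrib-*)
  open import Algebra.Properties.Ring ring
  open import Relation.Binary.Reasoning.Setoid setoid

  ι-^ : ∀ c n → ι (c ^ₖ n) ≈ ι c ^ n
  ι-^ c zero    = ι-1
  ι-^ c (suc n) = trans (ι-* c _) (*-congˡ (ι-^ c n))

  ι-fermat : ∀ c → ι c ^ order ≈ ι c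
  ι-fermat c = trans (sym (ι-^ c order)) (reflexive (≡.cong ι (fermat c)))

  -- The difference of distinct scalars is the image of a unit of F, so it cancels even if `R` has
  -- zero divisors.
  ι-separated : ∀ {c c′} → c ≢ c′ → Separated (ι c) (ι c′)
  ι-separated {c} {c′} c≢c′ z e with inverse (c′ K.- c) (λ d≡0 → c≢c′ (≡.sym (x-y≡0⇒x≡y c′ c d≡0)))
  ... | d⁻¹ , dd⁻¹≡1 = begin
    z                             ≈⟨ *-identityˡ z ⟨
    1# * z                        ≈⟨ *-congʳ (trans (reflexive (≡.cong ι dd⁻¹≡1)) ι-1) ⟨
    ι ((c′ K.- c) K.* d⁻¹) * z    ≈⟨ *-congʳ (trans (ι-* _ _) (*-congʳ (trans (ι-+ _ _) (+-congˡ (ι-- c))))) ⟩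
    ((ι c′ - ι c) * ι d⁻¹) * z    ≈⟨ solve 3 (λ w u z → (w :* u) :* z := u :* (w :* z)) refl (ι c′ - ι c) (ι d⁻¹) z ⟩
    ι d⁻¹ * ((ι c′ - ι c) * z)    ≈⟨ *-congˡ e ⟩
    ι d⁻¹ * 0#                    ≈⟨ zeroʳ _ ⟩
    0#                            ∎

  scalars : List Carrier
  scalars = List.map ι elements

  isPoly-splitOnScalars : ∀ {u f} → IsPoly u order f → (∀ c → f (ι c) ≈ 0#) →
                          ∀ y → f y ≈ u * rootProduct scalars y
  isPoly-splitOnScalars {u} {f} p roots = isPoly-split scalars
    (≡.subst (λ d → IsPoly u d f) (≡.sym (List.length-map ι elements)) p)
    (AllPairs.map⁺ (AllPairs.map ι-separated elements-unique))
    (All.map⁺ (All.tabulate (λ _ → roots _)))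

  -- In the difference the coefficients of degree q cancel, and q separated roots remain. Agreement
  -- thus extends from the scalars to all of `R`.
  isPoly-agreeOnScalars : ∀ {u f g} → IsPoly u order f → IsPoly u order g →
                          (∀ c → f (ι c) ≈ g (ι c)) → ∀ y → f y ≈ g y
  isPoly-agreeOnScalars {u} {f} {g} p q agree y = x∙y⁻¹≈ε⇒x≈y (f y) (g y) (trans
    (isPoly-splitOnScalars
      (isPoly-cong (-1-cancel u) (λ y → +-congˡ (-1*x≈-x (g y)))
        (isPoly-+ p (isPoly-* (- 1#) q)))
      (λ c → x≈y⇒x∙y⁻¹≈ε (agree c)) y)
    (zeroˡ _))
    where
    -1-cancel : ∀ u → u + - 1# * u ≈ 0#
    -1-cancel u = trans (+-congˡ (-1*x≈-x u)) (-‿inverseʳ u)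

  isPoly-order : IsPoly 1# order (_^ order)
  isPoly-order = isPoly-cong refl (λ y → ^-congˡ order (+-identityʳ y)) (isPoly-^ 0# order)

  -- Both sides of additivity are monic of degree q in y, so they agree as soon as they agree for y ∈ F;
  -- there the same argument in x applies. No binomial theorem and no characteristic is needed.
  ^order-+ : ∀ x y → (x + y) ^ order ≈ x ^ order + y ^ order
  ^order-+ x y = isPoly-agreeOnScalars
    (isPoly-cong refl (λ y → ^-congˡ order (+-comm y x)) (isPoly-^ x order))
    (isPoly-cong (+-identityʳ 1#) (λ y → +-comm _ _) (isPoly-+ isPoly-order (isPoly-const (x ^ order))))
    (λ c → trans (+scalar x c) (+-congˡ (sym (ι-fermat c)))) y
    where
    isPoly-const : ∀ b → IsPoly 0# order (λ _ → b)
    isPoly-const b = isPoly-lift (ℕ.<-≤-trans (s≤s z≤n) 2≤order) (constant λ _ → refl)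
    +scalar : ∀ x c → (x + ι c) ^ order ≈ x ^ order + ι c
    +scalar x c = isPoly-agreeOnScalars (isPoly-^ (ι c) order)
      (isPoly-cong (+-identityʳ 1#) (λ _ → refl) (isPoly-+ isPoly-order (isPoly-const (ι c))))
      (λ d → begin
        (ι d + ι c) ^ order         ≈⟨ ^-congˡ order (ι-+ d c) ⟨
        ι (d K.+ c) ^ order         ≈⟨ ι-fermat _ ⟩
        ι (d K.+ c)                 ≈⟨ ι-+ d c ⟩
        ι d + ι c                   ≈⟨ +-congʳ (ι-fermat d) ⟨
        ι d ^ order + ι c           ∎) x

  -- The q scalars are roots by Fermat, and `2≤order` keeps `- y` below the leading term.
  ^order-split : ∀ y → y ^ order - y ≈ rootProduct scalars y
  ^order-split y = trans (isPoly-splitOnScalars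
    (isPoly-cong (+-identityʳ 1#) (λ y → +-congˡ (-1*x≈-x y))
      (isPoly-+ isPoly-order (isPoly-lift 2≤order (isPoly-* (- 1#) isPoly-id))))
    (λ c → x≈y⇒x∙y⁻¹≈ε (ι-fermat c)) y) (*-identityˡ _)

  -- The map y ↦ y^(q^j), iterated instead of taken as one power so that additivity and
  -- multiplicativity pass from step to step.
  frob : ℕ → Carrier → Carrier
  frob zero    y = y
  frob (suc j) y = frob j y ^ order

  frob-cong : ∀ j {x y} → x ≈ y → frob j x ≈ frob j y
  frob-cong zero    x≈y = x≈y
  frob-cong (suc j) x≈y = ^-congˡ order (frob-cong j x≈y)

  frob-+ : ∀ j x y → frob j (x + y) ≈ frob j x + frob j y
  frob-+ zero    x y = refl
  frob-+ (suc j) x y = trans (^-congˡ order (frob-+ j x y)) (^order-+ _ _)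

  frob-* : ∀ j x y → frob j (x * y) ≈ frob j x * frob j y
  frob-* zero    x y = refl
  frob-* (suc j) x y = trans (^-congˡ order (frob-* j x y)) (^-distrib-* _ _ order)

  frob-ι : ∀ j c → frob j (ι c) ≈ ι c
  frob-ι zero    c = refl
  frob-ι (suc j) c = trans (^-congˡ order (frob-ι j c)) (ι-fermat c)

  frob-0 : ∀ j → frob j 0# ≈ 0#
  frob-0 j = trans (frob-cong j (sym ι-0)) (trans (frob-ι j _) ι-0)

  frob-∘ : ∀ i j y → frob i (frob j y) ≡ frob (i ℕ.+ j) y
  frob-∘ zero    j y = ≡.refl
  frob-∘ (suc i) j y = ≡.cong (_^ order) (frob-∘ i j y)

  frob-- : ∀ j x y → frob j (x - y) ≈ frob j x - frob j y
  frob-- j x y = begin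
    frob j (x - y)                              ≈⟨ solve 2 (λ a b → a := (a :+ b) :- b) refl _ (frob j y) ⟩
    (frob j (x - y) + frob j y) - frob j y      ≈⟨ +-congʳ (frob-+ j (x - y) y) ⟨
    frob j ((x - y) + y) - frob j y             ≈⟨ +-congʳ (frob-cong j (solve 2 (λ x y → (x :- y) :+ y := x) refl x y)) ⟩
    frob j x - frob j y                         ∎

  norm : ℕ → Carrier → Carrier
  norm zero    y = 1#
  norm (suc n) y = frob n y * norm n y

  norm-cong : ∀ n {x y} → x ≈ y → norm n x ≈ norm n y
  norm-cong zero    x≈y = refl
  norm-cong (suc n) x≈y = *-cong (frob-cong n x≈y) (norm-cong n x≈y)

  -- Frobenius fixes scalars, so each conjugate of `ι c * a + b` is linear in `ι c`, and the norm is
  -- a product of `n` linear factors with leading coefficient `norm n a`. Agreement is claimed at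
  -- scalars only: elsewhere the conjugates of the parameter intervene.
  norm-onLine : ∀ n a b → ∃ λ f → IsPoly (norm n a) n f × (∀ c → f (ι c) ≈ norm n (ι c * a + b))
  norm-onLine zero    a b = (λ _ → 1#) , constant (λ _ → refl) , λ _ → refl
  norm-onLine (suc n) a b with norm-onLine n a b
  ... | f , p , e = (λ y → (y * frob n a + frob n b) * f y) , isPoly-linear (frob n a) (frob n b) p ,
    λ c → *-cong (begin
      ι c * frob n a + frob n b           ≈⟨ +-congʳ (*-congʳ (frob-ι n c)) ⟨
      frob n (ι c) * frob n a + frob n b  ≈⟨ +-congʳ (frob-* n _ _) ⟨
      frob n (ι c * a) + frob n b         ≈⟨ frob-+ n _ _ ⟨
      frob n (ι c * a + b)                ∎) (e c)

  -- Telescoping: the q-th power shifts the conjugates by one, so the factor `y` is traded for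
  -- `frob n y`. The extra `y` on the left avoids a division.
  norm-^order : ∀ n y → norm n y ^ order * y ≈ norm n y * frob n y
  norm-^order zero    y = *-congʳ (trans (^-congˡ order (sym ι-1)) (trans (ι-fermat _) ι-1))
  norm-^order (suc n) y = begin
    (frob n y * norm n y) ^ order * y               ≈⟨ *-congʳ (^-distrib-* _ _ order) ⟩
    (frob n y ^ order * norm n y ^ order) * y       ≈⟨ *-assoc _ _ _ ⟩
    frob n y ^ order * (norm n y ^ order * y)       ≈⟨ *-congˡ (norm-^order n y) ⟩
    frob n y ^ order * (norm n y * frob n y)        ≈⟨ solve 3 (λ a b c → a :* (b :* c) := (c :* b) :* a) refl _ (norm n y) (frob n y) ⟩
    (frob n y * norm n y) * frob n y ^ order        ∎

  module Discrete (zeroOrUnit : ∀ a → a ≈ 0# ⊎ ∃ λ u → u * a ≈ 1#) (1≉0 : ¬ 1# ≈ 0#) where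

    cancel-zero : ∀ {a b} → ¬ a ≈ 0# → a * b ≈ 0# → b ≈ 0#
    cancel-zero {a} {b} a≉0 ab≈0 with zeroOrUnit a
    ... | inj₁ a≈0         = ⊥-elim (a≉0 a≈0)
    ... | inj₂ (u , ua≈1) = begin
      b             ≈⟨ *-identityˡ b ⟨
      1# * b        ≈⟨ *-congʳ ua≈1 ⟨
      (u * a) * b   ≈⟨ *-assoc u a b ⟩
      u * (a * b)   ≈⟨ *-congˡ ab≈0 ⟩
      u * 0#        ≈⟨ zeroʳ u ⟩
      0#            ∎

    *-nonzeroᴿ : ∀ {a b} → ¬ a ≈ 0# → ¬ b ≈ 0# → ¬ a * b ≈ 0#
    *-nonzeroᴿ a≉0 b≉0 ab≈0 = b≉0 (cancel-zero a≉0 ab≈0)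

    ≉⇒separated : ∀ {c c′} → ¬ c ≈ c′ → Separated c c′
    ≉⇒separated {c} {c′} c≉c′ _ = cancel-zero (λ e → c≉c′ (sym (x∙y⁻¹≈ε⇒x≈y c′ c e)))

    ^-nonzero : ∀ {a} → ¬ a ≈ 0# → ∀ n → ¬ a ^ n ≈ 0#
    ^-nonzero a≉0 zero    = 1≉0
    ^-nonzero a≉0 (suc n) = *-nonzeroᴿ a≉0 (^-nonzero a≉0 n)

    frob-nonzero : ∀ {a} → ¬ a ≈ 0# → ∀ j → ¬ frob j a ≈ 0#
    frob-nonzero a≉0 zero    = a≉0
    frob-nonzero a≉0 (suc j) = ^-nonzero (frob-nonzero a≉0 j) order

    norm-nonzero : ∀ {a} → ¬ a ≈ 0# → ∀ n → ¬ norm n a ≈ 0#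
    norm-nonzero a≉0 zero    = 1≉0
    norm-nonzero a≉0 (suc n) = *-nonzeroᴿ (frob-nonzero a≉0 n) (norm-nonzero a≉0 n)

    private
      rootOfProduct : ∀ cs z → rootProduct (List.map ι cs) z ≈ 0# → ∃ λ c → z ≈ ι c
      rootOfProduct []       z e = ⊥-elim (1≉0 e)
      rootOfProduct (c ∷ cs) z e with zeroOrUnit (z - ι c)
      ... | inj₁ z-c≈0      = c , x∙y⁻¹≈ε⇒x≈y z (ι c) z-c≈0
      ... | inj₂ (u , uw≈1) = rootOfProduct cs z
        (cancel-zero (λ w≈0 → 1≉0 (trans (sym uw≈1) (trans (*-congˡ w≈0) (zeroʳ u)))) e)

    -- The polynomial y^q - y is the product of the y - c over the scalars, and in a field one of
    -- these factors must vanish at `z`.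
    frob-fixed⇒scalar : ∀ {z} → z ^ order ≈ z → ∃ λ c → z ≈ ι c
    frob-fixed⇒scalar {z} e = rootOfProduct elements z
      (trans (sym (^order-split z)) (x≈y⇒x∙y⁻¹≈ε e))

    -- If `frob n a ≈ a`, cancelling `a` in `norm-^order` shows that the norm is its own q-th power.
    norm-scalar : ∀ n {a} → frob n a ≈ a → ¬ a ≈ 0# → ∃ λ c → norm n a ≈ ι c
    norm-scalar n {a} fixed a≉0 = frob-fixed⇒scalar (x∙y⁻¹≈ε⇒x≈y _ _ (cancel-zero a≉0 (begin
      a * (norm n a ^ order - norm n a)         ≈⟨ solve 3 (λ a x y → a :* (x :- y) := x :* a :- y :* a) refl a _ (norm n a) ⟩
      norm n a ^ order * a - norm n a * a       ≈⟨ +-congʳ (trans (norm-^order n a) (*-congˡ fixed)) ⟩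
      norm n a * a - norm n a * a               ≈⟨ -‿inverseʳ _ ⟩
      0#                                        ∎)))

    -- Iterates of Frobenius are injective in a field: `frob i` sends `frob j y - y` to 0.
    frob-order : ∀ {y i j} → frob i y ≈ frob (i ℕ.+ j) y → frob j y ≈ y
    frob-order {y} {i} {j} e with zeroOrUnit (frob j y - y)
    ... | inj₁ d≈0        = x∙y⁻¹≈ε⇒x≈y _ _ d≈0
    ... | inj₂ (u , ud≈1) = ⊥-elim (frob-nonzero
      (λ d≈0 → 1≉0 (trans (sym ud≈1) (trans (*-congˡ d≈0) (zeroʳ u)))) i (begin
        frob i (frob j y - y)               ≈⟨ frob-- i _ _ ⟩
        frob i (frob j y) - frob i y        ≈⟨ +-congʳ (reflexive (frob-∘ i j y)) ⟩
        frob (i ℕ.+ j) y - frob i y         ≈⟨ x≈y⇒x∙y⁻¹≈ε (sym e) ⟩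
        0#                                  ∎))

-- The polynomial ring F[X] on coefficient lists

module PolynomialRing (F : FiniteField) where
  open FieldProperties F using (fieldRing)
  open CommutativeRing fieldRing
  open IntegerSolver fieldRing

  Poly : Set
  Poly = List Carrier

  coeff : Poly → ℕ → Carrier
  coeff []      k       = 0#
  coeff (a ∷ p) zero    = a
  coeff (a ∷ p) (suc k) = coeff p k

  -- Lists with different numbers of trailing zeros represent the same polynomial.
  infix 4 _≈ₚ_
  record _≈ₚ_ (p q : Poly) : Set where
    constructor mk
    field at : ∀ k → coeff p k ≡ coeff q k
  open _≈ₚ_ public

  infixl 6 _+ₚ_
  infixl 7 _*ₚ_ _·ₚ_

  _+ₚ_ : Poly → Poly → Poly
  []      +ₚ q       = q
  (a ∷ p) +ₚ []      = a ∷ p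
  (a ∷ p) +ₚ (b ∷ q) = a + b ∷ p +ₚ q

  _·ₚ_ : Carrier → Poly → Poly
  c ·ₚ p = List.map (c *_) p

  -ₚ_ : Poly → Poly
  -ₚ p = List.map (-_) p

  _*ₚ_ : Poly → Poly → Poly
  []      *ₚ q = []
  (a ∷ p) *ₚ q = a ·ₚ q +ₚ (0# ∷ p *ₚ q)

  coeff-+ : ∀ p q k → coeff (p +ₚ q) k ≡ coeff p k + coeff q k
  coeff-+ []      q       k       = ≡.sym (+-identityˡ _)
  coeff-+ (a ∷ p) []      k       = ≡.sym (+-identityʳ _)
  coeff-+ (a ∷ p) (b ∷ q) zero    = ≡.refl
  coeff-+ (a ∷ p) (b ∷ q) (suc k) = coeff-+ p q k

  coeff-· : ∀ c p k → coeff (c ·ₚ p) k ≡ c * coeff p k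
  coeff-· c []      k       = ≡.sym (zeroʳ c)
  coeff-· c (a ∷ p) zero    = ≡.refl
  coeff-· c (a ∷ p) (suc k) = coeff-· c p k

  coeff-neg : ∀ p k → coeff (-ₚ p) k ≡ - coeff p k
  coeff-neg []      k       = ≡.sym -0#≈0# where open import Algebra.Properties.Ring ring
  coeff-neg (a ∷ p) zero    = ≡.refl
  coeff-neg (a ∷ p) (suc k) = coeff-neg p k

  ≈ₚ-refl : ∀ {p} → p ≈ₚ p
  ≈ₚ-refl = mk λ k → ≡.refl

  ≈ₚ-sym : ∀ {p q} → p ≈ₚ q → q ≈ₚ p
  ≈ₚ-sym e = mk λ k → ≡.sym (at e k)

  ≈ₚ-trans : ∀ {p q r} → p ≈ₚ q → q ≈ₚ r → p ≈ₚ r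
  ≈ₚ-trans e e′ = mk λ k → ≡.trans (at e k) (at e′ k)

  +ₚ-isAbelianGroup : IsAbelianGroup _≈ₚ_ _+ₚ_ [] -ₚ_
  +ₚ-isAbelianGroup = record
    { isGroup = record
      { isMonoid = record
        { isSemigroup = record
          { isMagma = record
            { isEquivalence = record { refl = ≈ₚ-refl ; sym = ≈ₚ-sym ; trans = ≈ₚ-trans }
            ; ∙-cong = λ {p} {q} {r} {s} e e′ → mk λ k → ≡.trans (coeff-+ p r k)
                (≡.trans (≡.cong₂ _+_ (at e k) (at e′ k)) (≡.sym (coeff-+ q s k))) }
          ; assoc = λ p q r → mk λ k → ≡.trans (coeff-+ (p +ₚ q) r k)
              (≡.trans (+-congʳ (coeff-+ p q k)) (≡.trans (+-assoc _ _ _)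
              (≡.trans (+-congˡ (≡.sym (coeff-+ q r k))) (≡.sym (coeff-+ p (q +ₚ r) k))))) }
        ; identity = (λ p → ≈ₚ-refl) , λ p → mk λ k → ≡.trans (coeff-+ p [] k) (+-identityʳ _) }
      ; inverse = (λ p → mk λ k → ≡.trans (coeff-+ (-ₚ p) p k)
                    (≡.trans (+-congʳ (coeff-neg p k)) (-‿inverseˡ _)))
                , (λ p → mk λ k → ≡.trans (coeff-+ p (-ₚ p) k)
                    (≡.trans (+-congˡ (coeff-neg p k)) (-‿inverseʳ _)))
      ; ⁻¹-cong = λ {p} {q} e → mk λ k → ≡.trans (coeff-neg p k)
          (≡.trans (≡.cong -_ (at e k)) (≡.sym (coeff-neg q k))) }
    ; comm = λ p q → mk λ k → ≡.trans (coeff-+ p q k)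
        (≡.trans (+-comm _ _) (≡.sym (coeff-+ q p k))) }

  private
    module P = IsAbelianGroup +ₚ-isAbelianGroup
    +ₚ-commutativeMonoid : CommutativeMonoid 0ℓ 0ℓ
    +ₚ-commutativeMonoid = record { isCommutativeMonoid = P.isCommutativeMonoid }
  open import Algebra.Properties.CommutativeSemigroup
    (CommutativeMonoid.commutativeSemigroup +ₚ-commutativeMonoid) using (interchange; x∙yz≈y∙xz)
  open import Relation.Binary.Reasoning.Setoid (CommutativeMonoid.setoid +ₚ-commutativeMonoid)

  ∷-cong : ∀ {a b p q} → a ≡ b → p ≈ₚ q → a ∷ p ≈ₚ b ∷ q
  ∷-cong a≡b e = mk λ { zero → a≡b ; (suc k) → at e k }

  0∷[]≈[] : 0# ∷ [] ≈ₚ []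
  0∷[]≈[] = mk λ { zero → ≡.refl ; (suc k) → ≡.refl }

  ·-cong : ∀ c {p q} → p ≈ₚ q → c ·ₚ p ≈ₚ c ·ₚ q
  ·-cong c {p} {q} e = mk λ k → ≡.trans (coeff-· c p k)
    (≡.trans (≡.cong (c *_) (at e k)) (≡.sym (coeff-· c q k)))

  ·-distribˡ-+ : ∀ c p q → c ·ₚ (p +ₚ q) ≈ₚ c ·ₚ p +ₚ c ·ₚ q
  ·-distribˡ-+ c p q = mk λ k → ≡.trans (coeff-· c (p +ₚ q) k) (≡.trans (≡.cong (c *_) (coeff-+ p q k))
    (≡.trans (distribˡ c _ _) (≡.trans (≡.sym (≡.cong₂ _+_ (coeff-· c p k) (coeff-· c q k)))
    (≡.sym (coeff-+ (c ·ₚ p) (c ·ₚ q) k)))))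

  ·-assoc : ∀ c d p → (c * d) ·ₚ p ≈ₚ c ·ₚ (d ·ₚ p)
  ·-assoc c d p = mk λ k → ≡.trans (coeff-· (c * d) p k) (≡.trans (*-assoc c d _)
    (≡.trans (≡.cong (c *_) (≡.sym (coeff-· d p k))) (≡.sym (coeff-· c (d ·ₚ p) k))))

  ·-identity : ∀ p → 1# ·ₚ p ≈ₚ p
  ·-identity p = mk λ k → ≡.trans (coeff-· 1# p k) (*-identityˡ _)

  ·-zero : ∀ p → 0# ·ₚ p ≈ₚ []
  ·-zero p = mk λ k → ≡.trans (coeff-· 0# p k) (zeroˡ _)

  *-congʳₚ : ∀ p {q r} → q ≈ₚ r → p *ₚ q ≈ₚ p *ₚ r
  *-congʳₚ []      e = ≈ₚ-refl
  *-congʳₚ (a ∷ p) e = P.∙-cong (·-cong a e) (∷-cong ≡.refl (*-congʳₚ p e))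

  *-zeroʳₚ : ∀ p → p *ₚ [] ≈ₚ []
  *-zeroʳₚ []      = ≈ₚ-refl
  *-zeroʳₚ (a ∷ p) = ≈ₚ-trans (∷-cong ≡.refl (*-zeroʳₚ p)) 0∷[]≈[]

  -- Multiplication recurses on its left factor; this is the mirrored recursion on the right one,
  -- from which commutativity follows.
  *-∷ʳ : ∀ p b q → p *ₚ (b ∷ q) ≈ₚ b ·ₚ p +ₚ (0# ∷ p *ₚ q)
  *-∷ʳ []      b q = ≈ₚ-sym 0∷[]≈[]
  *-∷ʳ (a ∷ p) b q = ∷-cong (≡.cong (_+ 0#) (*-comm a b)) (begin
    a ·ₚ q +ₚ p *ₚ (b ∷ q)                 ≈⟨ P.∙-congˡ {a ·ₚ q} (*-∷ʳ p b q) ⟩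
    a ·ₚ q +ₚ (b ·ₚ p +ₚ (0# ∷ p *ₚ q))    ≈⟨ x∙yz≈y∙xz (a ·ₚ q) (b ·ₚ p) _ ⟩
    b ·ₚ p +ₚ (a ·ₚ q +ₚ (0# ∷ p *ₚ q))    ∎)

  *-commₚ : ∀ p q → p *ₚ q ≈ₚ q *ₚ p
  *-commₚ []      q = ≈ₚ-sym (*-zeroʳₚ q)
  *-commₚ (a ∷ p) q = ≈ₚ-trans (P.∙-congˡ {a ·ₚ q} (∷-cong ≡.refl (*-commₚ p q))) (≈ₚ-sym (*-∷ʳ q a p))

  *-congₚ : ∀ {p q r s} → p ≈ₚ q → r ≈ₚ s → p *ₚ r ≈ₚ q *ₚ s
  *-congₚ {p} {q} {r} {s} e e′ = begin
    p *ₚ r   ≈⟨ *-congʳₚ p e′ ⟩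
    p *ₚ s   ≈⟨ *-commₚ p s ⟩
    s *ₚ p   ≈⟨ *-congʳₚ s e ⟩
    s *ₚ q   ≈⟨ *-commₚ s q ⟩
    q *ₚ s   ∎

  *-distribˡₚ : ∀ p q r → p *ₚ (q +ₚ r) ≈ₚ p *ₚ q +ₚ p *ₚ r
  *-distribˡₚ []      q r = ≈ₚ-refl
  *-distribˡₚ (a ∷ p) q r = begin
    a ·ₚ (q +ₚ r) +ₚ (0# ∷ p *ₚ (q +ₚ r))
      ≈⟨ P.∙-cong (·-distribˡ-+ a q r) (∷-cong (≡.sym (+-identityˡ 0#)) (*-distribˡₚ p q r)) ⟩
    (a ·ₚ q +ₚ a ·ₚ r) +ₚ ((0# ∷ p *ₚ q) +ₚ (0# ∷ p *ₚ r))
      ≈⟨ interchange (a ·ₚ q) (a ·ₚ r) _ _ ⟩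
    (a ·ₚ q +ₚ (0# ∷ p *ₚ q)) +ₚ (a ·ₚ r +ₚ (0# ∷ p *ₚ r)) ∎

  *-distribʳₚ : ∀ r p q → (p +ₚ q) *ₚ r ≈ₚ p *ₚ r +ₚ q *ₚ r
  *-distribʳₚ r p q = begin
    (p +ₚ q) *ₚ r        ≈⟨ *-commₚ (p +ₚ q) r ⟩
    r *ₚ (p +ₚ q)        ≈⟨ *-distribˡₚ r p q ⟩
    r *ₚ p +ₚ r *ₚ q     ≈⟨ P.∙-cong (*-commₚ r p) (*-commₚ r q) ⟩
    p *ₚ r +ₚ q *ₚ r     ∎

  ·-*-assoc : ∀ c p q → (c ·ₚ p) *ₚ q ≈ₚ c ·ₚ (p *ₚ q)
  ·-*-assoc c []      q = ≈ₚ-refl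
  ·-*-assoc c (a ∷ p) q = begin
    (c * a) ·ₚ q +ₚ (0# ∷ (c ·ₚ p) *ₚ q)
      ≈⟨ P.∙-cong (·-assoc c a q) (∷-cong (≡.sym (zeroʳ c)) (·-*-assoc c p q)) ⟩
    c ·ₚ (a ·ₚ q) +ₚ c ·ₚ (0# ∷ p *ₚ q)
      ≈⟨ ·-distribˡ-+ c (a ·ₚ q) (0# ∷ p *ₚ q) ⟨
    c ·ₚ (a ·ₚ q +ₚ (0# ∷ p *ₚ q)) ∎

  *-assocₚ : ∀ p q r → (p *ₚ q) *ₚ r ≈ₚ p *ₚ (q *ₚ r)
  *-assocₚ []      q r = ≈ₚ-refl
  *-assocₚ (a ∷ p) q r = begin
    (a ·ₚ q +ₚ (0# ∷ p *ₚ q)) *ₚ r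
      ≈⟨ *-distribʳₚ r (a ·ₚ q) (0# ∷ p *ₚ q) ⟩
    (a ·ₚ q) *ₚ r +ₚ (0# ·ₚ r +ₚ (0# ∷ (p *ₚ q) *ₚ r))
      ≈⟨ P.∙-cong (·-*-assoc a q r) (P.∙-cong (·-zero r) (∷-cong ≡.refl (*-assocₚ p q r))) ⟩
    a ·ₚ (q *ₚ r) +ₚ (0# ∷ p *ₚ (q *ₚ r)) ∎

  constₚ : Carrier → Poly
  constₚ c = c ∷ []

  const-* : ∀ c p → constₚ c *ₚ p ≈ₚ c ·ₚ p
  const-* c p = begin
    c ·ₚ p +ₚ (0# ∷ [])   ≈⟨ P.∙-congˡ {c ·ₚ p} 0∷[]≈[] ⟩
    c ·ₚ p +ₚ []          ≈⟨ P.identityʳ (c ·ₚ p) ⟩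
    c ·ₚ p                ∎

  *-identityˡₚ : ∀ p → constₚ 1# *ₚ p ≈ₚ p
  *-identityˡₚ p = ≈ₚ-trans (const-* 1# p) (·-identity p)

  polyRing : CommutativeRing 0ℓ 0ℓ
  polyRing = record
    { isCommutativeRing = record
      { isRing = record
        { +-isAbelianGroup = +ₚ-isAbelianGroup
        ; *-cong = *-congₚ
        ; *-assoc = *-assocₚ
        ; *-identity = *-identityˡₚ , λ p → ≈ₚ-trans (*-commₚ p (constₚ 1#)) (*-identityˡₚ p)
        ; distrib = *-distribˡₚ , *-distribʳₚ }
      ; *-comm = *-commₚ } }

  X : Poly
  X = 0# ∷ 1# ∷ []

  X* : ∀ p → X *ₚ p ≈ₚ 0# ∷ p
  X* p = P.∙-cong (·-zero p) (∷-cong ≡.refl (*-identityˡₚ p))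

  -- Writes the list constructor in ring operations, which opens recursion on lists to the ring
  -- solver.
  ∷-split : ∀ a p → a ∷ p ≈ₚ constₚ a +ₚ X *ₚ p
  ∷-split a p = begin
    a ∷ p                      ≈⟨ ∷-cong (≡.sym (+-identityʳ a)) ≈ₚ-refl ⟩
    constₚ a +ₚ (0# ∷ p)       ≈⟨ P.∙-congˡ {constₚ a} (X* p) ⟨
    constₚ a +ₚ X *ₚ p         ∎

  constₚ-isRingHomomorphism : IsRingHomomorphism rawRing (CommutativeRing.rawRing polyRing) constₚ
  constₚ-isRingHomomorphism = record
    { isSemiringHomomorphism = record
      { isNearSemiringHomomorphism = record
        { +-isMonoidHomomorphism = record
          { isMagmaHomomorphism = record
            { isRelHomomorphism = record { cong = λ { ≡.refl → ≈ₚ-refl } }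
            ; homo = λ _ _ → ≈ₚ-refl }
          ; ε-homo = 0∷[]≈[] }
        ; *-homo = λ a b → ≈ₚ-sym (const-* a (constₚ b)) }
      ; 1#-homo = ≈ₚ-refl }
    ; -‿homo = λ _ → ≈ₚ-refl }

-- Divisibility, Euclid's algorithm and maximal factors

module RingDivisibility (R : CommutativeRing 0ℓ 0ℓ) where
  open CommutativeRing R
  open import Algebra.Properties.Semiring.Divisibility semiring public
    using (_∣_; _,_; module _∣ʳ_; _∣0; ∣-respʳ; ∣ʳ-trans; ∣ʳ-refl; x∣ʳy⇒x∣ʳzy)
  open import Algebra.Properties.Ring ring using (-‿distribˡ-*)

  ∣-+ : ∀ {x y z} → x ∣ y → x ∣ z → x ∣ y + z
  ∣-+ (p , e) (q , e′) = p + q , trans (distribʳ _ p q) (+-cong e e′)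

  ∣-neg : ∀ {x y} → x ∣ y → x ∣ - y
  ∣-neg (p , e) = - p , trans (sym (-‿distribˡ-* p _)) (-‿cong e)

module PolynomialDivision (F : FiniteField) where
  open FiniteField F using (inverse; _≟_; 0≢1)
  open FieldProperties F
  open PolynomialRing F
  private
    module K = CommutativeRing fieldRing
    module KS = IntegerSolver fieldRing
  open K using (0#; 1#)
  open CommutativeRing polyRing hiding (0#; 1#)
  open IntegerSolver polyRing
  open RingDivisibility polyRing
  open import Relation.Binary.Reasoning.Setoid setoid

  Deg< : ℕ → Poly → Set
  Deg< d p = ∀ k → d ℕ.≤ k → coeff p k ≡ 0#

  -- As in `IsPoly`, `u` may vanish; the degree is exactly `d` only together with `u ≢ 0#`.
  Lead : K.Carrier → ℕ → Poly → Set
  Lead u d p = coeff p d ≡ u × Deg< (suc d) p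

  Monic : ℕ → Poly → Set
  Monic = Lead 1#

  Deg<-cong : ∀ {d p q} → p ≈ q → Deg< d p → Deg< d q
  Deg<-cong e deg k d≤k = ≡.trans (≡.sym (at e k)) (deg k d≤k)

  lead-cong : ∀ {u d p q} → p ≈ q → Lead u d p → Lead u d q
  lead-cong {d = d} e (l , deg) = ≡.trans (≡.sym (at e d)) l , Deg<-cong e deg

  Deg<-+ : ∀ {d p q} → Deg< d p → Deg< d q → Deg< d (p + q)
  Deg<-+ {p = p} {q} P Q k l = ≡.trans (coeff-+ p q k) (≡.trans (≡.cong₂ K._+_ (P k l) (Q k l)) (K.+-identityʳ 0#))

  Deg<-· : ∀ {d} c p → Deg< d p → Deg< d (c ·ₚ p)
  Deg<-· c p P k l = ≡.trans (coeff-· c p k) (≡.trans (≡.cong (c K.*_) (P k l)) (K.zeroʳ c))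

  Deg<-neg : ∀ {d p} → Deg< d p → Deg< d (- p)
  Deg<-neg {p = p} P k l = ≡.trans (coeff-neg p k) (≡.trans (≡.cong K.-_ (P k l)) -0#≈0#)
    where open import Algebra.Properties.Ring K.ring using (-0#≈0#)

  Deg<-const : ∀ {d} c → 1 ℕ.≤ d → Deg< d (constₚ c)
  Deg<-const c 1≤d zero    d≤0 = ⊥-elim (ℕ.<⇒≱ 1≤d d≤0)
  Deg<-const c 1≤d (suc k) _   = ≡.refl

  Deg<0⇒≈0 : ∀ {p} → Deg< 0 p → p ≈ []
  Deg<0⇒≈0 deg = mk λ k → deg k z≤n

  lead-* : ∀ {u v d e p q} → Lead u d p → Lead v e q → Lead (u K.* v) (d ℕ.+ e) (p * q)
  lead-* {v = v} {p = []} (≡.refl , _) _ = ≡.sym (K.zeroˡ v) , λ _ _ → ≡.refl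
  lead-* {u} {v} {zero} {e} {a ∷ p} {q} (≡.refl , degp) (le , degq) = lead-cong a·q≈ (a·q-lead , Deg<-· a q degq)
    where
    a·q-lead : coeff (a ·ₚ q) e ≡ a K.* v
    a·q-lead = ≡.trans (coeff-· a q e) (≡.cong (a K.*_) le)
    p≈0 : p ≈ []
    p≈0 = mk λ k → degp (suc k) (s≤s z≤n)
    a·q≈ : a ·ₚ q ≈ (a ∷ p) * q
    a·q≈ = begin
      a ·ₚ q                   ≈⟨ +-identityʳ (a ·ₚ q) ⟨
      a ·ₚ q + []              ≈⟨ +-congˡ {a ·ₚ q} (trans (∷-cong ≡.refl (*-cong p≈0 (refl {q}))) 0∷[]≈[]) ⟨
      a ·ₚ q + (0# ∷ p * q)    ∎
  lead-* {u} {v} {suc d} {e} {a ∷ p} {q} (lp , degp) lq@(_ , degq)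
    with lead-* {p = p} {q = q} (lp , λ k l → degp (suc k) (s≤s l)) lq
  ... | lpq , degpq =
    ≡.trans (coeff-+ (a ·ₚ q) _ (suc (d ℕ.+ e))) (≡.trans
      (≡.cong₂ K._+_ (Deg<-· a q degq _ (s≤s (ℕ.m≤n+m e d))) lpq) (K.+-identityˡ _)) ,
    Deg<-+ {p = a ·ₚ q} (λ k l → Deg<-· a q degq k (ℕ.≤-trans (s≤s (ℕ.m≤n+m e (suc d))) l))
      (λ { zero () ; (suc k) (s≤s l) → degpq k l })

  monic-* : ∀ {d e p q} → Monic d p → Monic e q → Monic (d ℕ.+ e) (p * q)
  monic-* {p = p} {q} P Q with lead-* {p = p} {q} P Q
  ... | l , deg = ≡.trans l (K.*-identityˡ 1#) , deg

  zeroOrLead : ∀ p → p ≈ [] ⊎ ∃₂ λ u d → u ≢ 0# × Lead u d p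
  zeroOrLead [] = inj₁ refl
  zeroOrLead (a ∷ p) with zeroOrLead p
  ... | inj₂ (u , d , u≢0 , l , deg) = inj₂ (u , suc d , u≢0 , l , λ { zero () ; (suc k) (s≤s l) → deg k l })
  ... | inj₁ p≈0 with a ≟ 0#
  ...   | yes ≡.refl = inj₁ (trans (∷-cong ≡.refl p≈0) 0∷[]≈[])
  ...   | no a≢0     = inj₂ (a , 0 , a≢0 , ≡.refl , λ { zero () ; (suc k) _ → at p≈0 k })

  lead-< : ∀ {u d e p} → u ≢ 0# → Lead u d p → Deg< e p → d ℕ.< e
  lead-< {d = d} {e} u≢0 (l , _) deg with d ℕ.<? e
  ... | yes d<e = d<e
  ... | no d≮e  = ⊥-elim (u≢0 (≡.trans (≡.sym l) (deg d (ℕ.≮⇒≥ d≮e))))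

  lead-unique : ∀ {u v d e p} → u ≢ 0# → v ≢ 0# → Lead u d p → Lead v e p → d ≡ e × u ≡ v
  lead-unique {p = p} u≢0 v≢0 lu@(l , deg) lv@(l′ , deg′)
    with ℕ.≤-antisym (ℕ.≤-pred (lead-< {p = p} u≢0 lu deg′)) (ℕ.≤-pred (lead-< {p = p} v≢0 lv deg))
  ... | ≡.refl = ≡.refl , ≡.trans (≡.sym l) l′

  1≢0 : 1# ≢ 0#
  1≢0 = 0≢1 ∘ ≡.sym

  monic≉0 : ∀ {d p} → Monic d p → ¬ p ≈ []
  monic≉0 {d} (l , _) p≈0 = 1≢0 (≡.trans (≡.sym l) (at p≈0 d))

  monic-scale : ∀ {u d p} → u ≢ 0# → Lead u d p → ∃ λ u⁻¹ → Monic d (u⁻¹ ·ₚ p) × u ·ₚ (u⁻¹ ·ₚ p) ≈ p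
  monic-scale {u} {d} {p} u≢0 (l , deg) with inverse u u≢0
  ... | u⁻¹ , uu⁻¹≡1 = u⁻¹ ,
    (≡.trans (coeff-· u⁻¹ p d) (≡.trans (≡.cong (u⁻¹ K.*_) l) (≡.trans (K.*-comm u⁻¹ u) uu⁻¹≡1)) , Deg<-· u⁻¹ p deg) ,
    (begin
      u ·ₚ (u⁻¹ ·ₚ p)     ≈⟨ ·-assoc u u⁻¹ p ⟨
      (u K.* u⁻¹) ·ₚ p    ≡⟨ ≡.cong (_·ₚ p) uu⁻¹≡1 ⟩
      1# ·ₚ p             ≈⟨ ·-identity p ⟩
      p                   ∎)

  -- Lists begin with the constant term, so the tail is divided first. From b = qP + r follows a +
  -- Xb = (Xq)P + (a + Xr), and a + Xr has degree at most D: subtracting its coefficient at X^D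
  -- times P completes the step.
  divMod : ∀ {D P} → Monic D P → ∀ a → ∃₂ λ q r → a ≈ q * P + r × Deg< D r
  divMod         mP []      = [] , [] , refl , λ _ _ → ≡.refl
  divMod {D} {P} mP (a ∷ b) with divMod mP b
  ... | q , r , b≈ , deg = X * q + constₚ u , (a ∷ r) - constₚ u * P , equality , small
    where
    u = coeff (a ∷ r) D
    deg′ : Deg< (suc D) (a ∷ r)
    deg′ zero    ()
    deg′ (suc k) (s≤s l) = deg k l
    equality : a ∷ b ≈ (X * q + constₚ u) * P + ((a ∷ r) - constₚ u * P)
    equality = begin
      a ∷ b                                                                 ≈⟨ ∷-split a b ⟩
      constₚ a + X * b                                                      ≈⟨ +-congˡ {constₚ a} (*-congˡ {X} b≈) ⟩
      constₚ a + X * (q * P + r)                                            ≈⟨ solve 6 (λ A X q P r U → A :+ X :* (q :* P :+ r) := (X :* q :+ U) :* P :+ ((A :+ X :* r) :- U :* P)) refl (constₚ a) X q P r (constₚ u) ⟩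
      (X * q + constₚ u) * P + ((constₚ a + X * r) - constₚ u * P)          ≈⟨ +-congˡ {(X * q + constₚ u) * P} (+-congʳ { - (constₚ u * P)} (∷-split a r)) ⟨
      (X * q + constₚ u) * P + ((a ∷ r) - constₚ u * P)                     ∎
    coeff-small : ∀ k → coeff ((a ∷ r) - constₚ u * P) k ≡ coeff (a ∷ r) k K.- u K.* coeff P k
    coeff-small k = ≡.trans (coeff-+ (a ∷ r) (- (constₚ u * P)) k) (≡.cong (coeff (a ∷ r) k K.+_)
      (≡.trans (coeff-neg (constₚ u * P) k) (≡.cong K.-_ (≡.trans (at (const-* u P) k) (coeff-· u P k)))))
    small : Deg< D ((a ∷ r) - constₚ u * P)
    small k D≤k with ℕ.m≤n⇒m<n∨m≡n D≤k
    ... | inj₁ D<k    = ≡.trans (coeff-small k) (≡.trans (≡.cong₂ (λ x y → x K.- u K.* y) (deg′ k D<k) (proj₂ mP k D<k))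
                          (KS.solve 1 (λ u → KS.con 0ℤ KS.:- u KS.:* KS.con 0ℤ KS.:= KS.con 0ℤ) ≡.refl u))
    ... | inj₂ ≡.refl = ≡.trans (coeff-small k) (≡.trans (≡.cong (λ y → u K.- u K.* y) (proj₁ mP))
                          (KS.solve 1 (λ u → u KS.:- u KS.:* KS.con 1ℤ KS.:= KS.con 0ℤ) ≡.refl u))

  small-multiple≈0 : ∀ {D P r} → Monic D P → Deg< D r → P ∣ r → r ≈ []
  small-multiple≈0 {D} {P} {r} mP deg (h , hP≈r) with zeroOrLead h
  ... | inj₁ h≈0 = trans (sym hP≈r) (*-congʳ {P} h≈0)
  ... | inj₂ (u , d , u≢0 , l) = ⊥-elim (ℕ.<⇒≱
    (lead-< {p = r} (*-nonzero u≢0 1≢0) (lead-cong hP≈r (lead-* {p = h} {P} l mP)) deg) (ℕ.m≤n+m D d))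

  ∤const1 : ∀ {d P} → Monic (suc d) P → ¬ P ∣ constₚ 1#
  ∤const1 mP P∣1 = 1≢0 (at (small-multiple≈0 mP (Deg<-const 1# (s≤s z≤n)) P∣1) 0)

  monic-quotient : ∀ {d e g f h} → Monic d g → Monic e f → h * g ≈ f → ∃ λ k → Monic k h × k ℕ.+ d ≡ e
  monic-quotient {d} {e} {g} {f} {h} mg mf hg≈f with zeroOrLead h
  ... | inj₁ h≈0 = ⊥-elim (monic≉0 mf (trans (sym hg≈f) (*-congʳ {g} h≈0)))
  ... | inj₂ (u , k , u≢0 , l) with lead-unique {p = f} (*-nonzero u≢0 1≢0) 1≢0 (lead-cong hg≈f (lead-* {p = h} {g} l mg)) mf
  ...   | k+d≡e , u*1≡1 = k , ≡.subst (λ u → Lead u k h) (≡.trans (≡.sym (K.*-identityʳ u)) u*1≡1) l , k+d≡e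

  monic0≈1 : ∀ {p} → Monic 0 p → p ≈ constₚ 1#
  monic0≈1 (l , deg) = mk λ { zero → l ; (suc k) → deg (suc k) (s≤s z≤n) }

  -- Only the cofactor of `a` is stored; that of `P` is hidden as the quotient in `combination`.
  record Bezout (P a : Poly) : Set where
    field
      degree         : ℕ
      divisor        : Poly
      monic          : Monic degree divisor
      divides-left   : divisor ∣ P
      divides-right  : divisor ∣ a
      cofactor       : Poly
      combination    : P ∣ cofactor * a - divisor

  -- Euclid's algorithm: the pair (P, a) passes to (s, P), where s is the remainder of a scaled to
  -- be monic, so that division by it is again possible.
  bezout : ∀ D P → Monic D P → ∀ a → Bezout P a
  bezout = <-rec _ step
    where
    step : ∀ D → (∀ {E} → E ℕ.< D → ∀ P → Monic E P → ∀ a → Bezout P a) →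
           ∀ P → Monic D P → ∀ a → Bezout P a
    step D rec P mP a with divMod mP a
    ... | q , r , a≈ , deg with zeroOrLead r
    ...   | inj₁ r≈0 = record
      { degree = D ; divisor = P ; monic = mP ; divides-left = ∣ʳ-refl
      ; divides-right = q , sym (trans a≈ (trans (+-congˡ {q * P} r≈0) (+-identityʳ (q * P))))
      ; cofactor = [] ; combination = ∣-neg {P} {P} ∣ʳ-refl }
    ...   | inj₂ (u , e , u≢0 , l) with monic-scale {p = r} u≢0 l
    ...     | c , ms , us≈r = record
      { degree = B.degree ; divisor = g ; monic = B.monic ; divides-left = B.divides-right
      ; divides-right = ∣-respʳ (sym a≈) (∣-+ (x∣ʳy⇒x∣ʳzy q B.divides-right) (∣-respʳ (trans (const-* u s) us≈r) (x∣ʳy⇒x∣ʳzy (constₚ u) B.divides-left)))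
      -- The recursive call gives g = vP - ws with s = c(a - qP), hence g = (v + wcq)P - wca.
      ; cofactor = - (w * constₚ c)
      ; combination = - (v + w * constₚ c * q) , combination′ }
      where
      s = c ·ₚ r
      b : Bezout s P
      b = rec (lead-< {p = r} u≢0 l deg) s ms P
      module B = Bezout b
      g = B.divisor
      v = B.cofactor
      w = _∣ʳ_.quotient B.combination
      s≈ : s ≈ constₚ c * (a - q * P)
      s≈ = trans (sym (const-* c r)) (*-congˡ {constₚ c} (trans
        (solve 2 (λ r m → r := (m :+ r) :- m) refl r (q * P)) (+-congʳ { - (q * P)} (sym a≈))))
      g≈ : v * P - w * (constₚ c * (a - q * P)) ≈ g
      g≈ = begin
        v * P - w * (constₚ c * (a - q * P))
          ≈⟨ +-congˡ {v * P} (-‿cong (trans (*-congˡ {w} (sym s≈)) (_∣ʳ_.equality B.combination))) ⟩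
        v * P - (v * P - g)
          ≈⟨ solve 2 (λ m g → m :- (m :- g) := g) refl (v * P) g ⟩
        g ∎
      combination′ : - (v + w * constₚ c * q) * P ≈ - (w * constₚ c) * a - g
      combination′ = begin
        - (v + w * constₚ c * q) * P
          ≈⟨ solve 6 (λ v w c q P a → :- (v :+ w :* c :* q) :* P := :- (w :* c) :* a :- (v :* P :- w :* (c :* (a :- q :* P)))) refl v w (constₚ c) q P a ⟩
        - (w * constₚ c) * a - (v * P - w * (constₚ c * (a - q * P)))
          ≈⟨ +-congˡ { - (w * constₚ c) * a} (-‿cong g≈) ⟩
        - (w * constₚ c) * a - g ∎

  -- Irreducibility in the form used: every residue is zero or invertible. Units of F[X] satisfy it
  -- as well, hence the accompanying `Monic (suc e)`.
  Maximal : Poly → Set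
  Maximal P = ∀ a → P ∣ a ⊎ ∃ λ u → P ∣ u * a - constₚ 1#

  ProperFactor : ℕ → Poly → Set
  ProperFactor D P = ∃₂ λ e g → suc e ℕ.< D × Monic (suc e) g × g ∣ P

  -- The gcd of P and a has degree 0, degree D, or a degree strictly between: then a is invertible
  -- mod P, divisible by P, or exhibits a factor of P.
  divides⊎coprime⊎factor : ∀ {D P} → Monic D P → ∀ a → (P ∣ a ⊎ ∃ λ u → P ∣ u * a - constₚ 1#) ⊎ ProperFactor D P
  divides⊎coprime⊎factor {D} {P} mP a = cases (bezout D P mP a)
    where
    cases : Bezout P a → (P ∣ a ⊎ ∃ λ u → P ∣ u * a - constₚ 1#) ⊎ ProperFactor D P
    cases record { degree = zero ; divisor = g ; monic = mg ; cofactor = u ; combination = comb } =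
      inj₁ (inj₂ (u , ∣-respʳ (+-congˡ {u * a} (-‿cong (monic0≈1 {g} mg))) comb))
    cases record { degree = suc e ; divisor = g ; monic = mg ; divides-left = g∣P@(h , hg≈P) ; divides-right = g∣a }
      with monic-quotient {f = P} {h} mg mP hg≈P
    ... | suc k , _ , ≡.refl = inj₂ (e , g , s≤s (ℕ.m≤n+m (suc e) k) , mg , g∣P)
    ... | zero , mh , _ = inj₁ (inj₁ (∣ʳ-trans P∣g g∣a))
      where
      P∣g : P ∣ g
      P∣g = constₚ 1# , (begin
        constₚ 1# * P   ≈⟨ *-identityˡₚ P ⟩
        P               ≈⟨ hg≈P ⟨
        h * g           ≈⟨ *-congʳ {g} (monic0≈1 {h} mh) ⟩
        constₚ 1# * g   ≈⟨ *-identityˡₚ g ⟩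
        g               ∎)

  toVec : ∀ {d r} → Deg< d r → ∃ λ (v : Vec K.Carrier d) → Vec.toList v ≈ r
  toVec {zero} deg = [] , sym (Deg<0⇒≈0 deg)
  toVec {suc d} {[]} deg with toVec {d} {[]} (λ _ _ → ≡.refl)
  ... | v , e = 0# ∷ v , trans (∷-cong ≡.refl e) 0∷[]≈[]
  toVec {suc d} {a ∷ r} deg with toVec {d} {r} (λ k l → deg (suc k) (s≤s l))
  ... | v , e = a ∷ v , ∷-cong ≡.refl e

  toList-deg : ∀ {d} (v : Vec K.Carrier d) → Deg< d (Vec.toList v)
  toList-deg []      k       _       = ≡.refl
  toList-deg (x ∷ v) zero    ()
  toList-deg (x ∷ v) (suc k) (s≤s l) = toList-deg v k l

  -- Maximality depends only on remainders mod P, and those are listed by `vectors D`. A remainder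
  -- that is neither divisible by P nor invertible yields a factor.
  maximal⊎factor : ∀ {D P} → Monic D P → Maximal P ⊎ ProperFactor D P
  maximal⊎factor {D} {P} mP with scan (vectors D)
    where
    Good : Vec K.Carrier D → Set
    Good v = P ∣ Vec.toList v ⊎ ∃ λ u → P ∣ u * Vec.toList v - constₚ 1#
    scan : ∀ vs → All Good vs ⊎ ProperFactor D P
    scan [] = inj₁ []
    scan (v ∷ vs) with divides⊎coprime⊎factor mP (Vec.toList v) | scan vs
    ... | inj₂ factor | _           = inj₂ factor
    ... | inj₁ _      | inj₂ factor = inj₂ factor
    ... | inj₁ good   | inj₁ goods  = inj₁ (good ∷ goods)
  ... | inj₂ factor = inj₂ factor
  ... | inj₁ goods  = inj₁ maximal
    where
    maximal : Maximal P
    maximal a with divMod mP a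
    ... | q , r , a≈ , deg with toVec {r = r} deg
    ...   | v , v≈r with All.lookup goods (vectors-complete v)
    ...     | inj₁ P∣v = inj₁ (∣-respʳ (trans (+-congˡ {q * P} v≈r) (sym a≈)) (∣-+ (q , refl) P∣v))
    ...     | inj₂ (u , P∣uv-1) = inj₂ (u , ∣-respʳ (begin
      u * q * P + (u * Vec.toList v - constₚ 1#)
        ≈⟨ solve 5 (λ u q P v e → u :* q :* P :+ (u :* v :- e) := u :* (q :* P :+ v) :- e) refl u q P (Vec.toList v) (constₚ 1#) ⟩
      u * (q * P + Vec.toList v) - constₚ 1#
        ≈⟨ +-congʳ { - constₚ 1#} (*-congˡ {u} (trans (+-congˡ {q * P} v≈r) (sym a≈))) ⟩
      u * a - constₚ 1# ∎) (∣-+ (u * q , refl) P∣uv-1))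

  MaximalFactor : Poly → Set
  MaximalFactor h = ∃₂ λ e P → Monic (suc e) P × P ∣ h × Maximal P

  maximalFactor : ∀ D h → Monic (suc D) h → MaximalFactor h
  maximalFactor = <-rec _ step
    where
    step : ∀ D → (∀ {E} → E ℕ.< D → ∀ h → Monic (suc E) h → MaximalFactor h) →
           ∀ h → Monic (suc D) h → MaximalFactor h
    step D rec h mh with maximal⊎factor mh
    ... | inj₁ maximal = D , h , mh , ∣ʳ-refl , maximal
    ... | inj₂ (e , g , s≤s e<D , mg , g∣h) with rec e<D g mg
    ...   | e′ , P , mP , P∣g , maximal = e′ , P , mP , ∣ʳ-trans P∣g g∣h , maximal

  maximal-∣? : ∀ {d P} → Monic (suc d) P → Maximal P → ∀ a → Dec (P ∣ a)
  maximal-∣? {P = P} mP maximal a with maximal a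
  ... | inj₁ P∣a = yes P∣a
  ... | inj₂ (u , P∣ua-1) = no λ P∣a → ∤const1 mP (∣-respʳ
    (solve 2 (λ m e → m :- (m :- e) := e) refl (u * a) (constₚ 1#))
    (∣-+ {P} (x∣ʳy⇒x∣ʳzy u P∣a) (∣-neg {P} P∣ua-1)))

  -- Euclid's lemma, from b = u(ab) - b(ua - 1).
  maximal-prime : ∀ {P a b} → Maximal P → P ∣ a * b → ¬ P ∣ a → P ∣ b
  maximal-prime {P} {a} {b} maximal P∣ab P∤a with maximal a
  ... | inj₁ P∣a = ⊥-elim (P∤a P∣a)
  ... | inj₂ (u , (h , hP≈)) = ∣-respʳ
    (trans (solve 4 (λ u a b e → u :* (a :* b) :- b :* (u :* a :- e) := b :* e) refl u a b (constₚ 1#))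
           (trans (*-comm b (constₚ 1#)) (*-identityˡₚ b)))
    (∣-+ {P} (x∣ʳy⇒x∣ʳzy u P∣ab) (∣-neg {P} (x∣ʳy⇒x∣ʳzy b (h , hP≈))))

  SquareFree : Poly → Set
  SquareFree f = ∀ {e} Q → Monic (suc e) Q → ¬ (Q * Q) ∣ f

  ExclusiveFactor : Poly → Poly → Set
  ExclusiveFactor f g = ∃₂ λ e P → Monic (suc e) P × Maximal P × P ∣ f × ¬ P ∣ g

  -- Any maximal factor of f that also divides g is divided out of both, which keeps deg g < deg f.
  exclusiveFactor : ∀ d {f} → Monic d f → SquareFree f → ∀ {e g} → Monic e g → e ℕ.< d → ExclusiveFactor f g
  exclusiveFactor d mf = <-rec Statement step d _ mf
    where
    Statement : ℕ → Set
    Statement d = ∀ f → Monic d f → SquareFree f → ∀ {e g} → Monic e g → e ℕ.< d → ExclusiveFactor f g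
    step : ∀ d → (∀ {d′} → d′ ℕ.< d → Statement d′) → Statement d
    step (suc d) rec f mf sf {e} {g} mg e<d with maximalFactor d f mf
    ... | k , P , mP , P∣f@(f′ , f′P≈f) , maximal with maximal-∣? mP maximal g
    ...   | no P∤g = k , P , mP , maximal , P∣f , P∤g
    ...   | yes (g′ , g′P≈g)
      with monic-quotient {f = f} {f′} mP mf f′P≈f | monic-quotient {f = g} {g′} mP mg g′P≈g
    ...     | df , mf′ , df+k≡d | dg , mg′ , dg+k≡e
      with rec (≡.subst (df ℕ.<_) df+k≡d (ℕ.m<m+n df (s≤s z≤n))) f′ mf′
             (λ Q mQ QQ∣f′ → sf Q mQ (∣-respʳ (trans (*-comm P f′) f′P≈f) (x∣ʳy⇒x∣ʳzy P QQ∣f′)))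
             mg′ (ℕ.+-cancelʳ-< (suc k) dg df (≡.subst₂ ℕ._<_ (≡.sym dg+k≡e) (≡.sym df+k≡d) e<d))
    ...       | k′ , P′ , mP′ , maximal′ , P′∣f′@(h , hP′≈f′) , P′∤g′ =
      k′ , P′ , mP′ , maximal′ , ∣-respʳ (trans (*-comm P f′) f′P≈f) (x∣ʳy⇒x∣ʳzy P P′∣f′) ,
      -- If `P′` divided g = g′P without dividing g′, it would divide P; as it also divides f′, its
      -- square would divide f = f′P.
      λ P′∣g → square (maximal-prime {P′} {g′} {P} maximal′ (∣-respʳ (sym g′P≈g) P′∣g) P′∤g′)
      where
      square : ¬ P′ ∣ P
      square (h′ , h′P′≈P) = sf P′ mP′ (h * h′ , (begin
        h * h′ * (P′ * P′)       ≈⟨ solve 3 (λ h h′ P → h :* h′ :* (P :* P) := (h :* P) :* (h′ :* P)) refl h h′ P′ ⟩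
        (h * P′) * (h′ * P′)     ≈⟨ *-cong hP′≈f′ h′P′≈P ⟩
        f′ * P                   ≈⟨ f′P≈f ⟩
        f                        ∎))

-- A factor of X^(q^n) - X modulo which X has exact Frobenius period n

module PeriodicFactor (F : FiniteField) where
  open FiniteField F using (order)
  open FieldProperties F
  open PolynomialRing F
  open PolynomialDivision F
  open Frobenius F polyRing constₚ constₚ-isRingHomomorphism using (frob)
  private
    module K = CommutativeRing fieldRing
    module KMult = Algebra.Properties.Semiring.Mult K.semiring
  open K using (0#; 1#)
  open CommutativeRing polyRing hiding (0#; 1#)
  open IntegerSolver polyRing
  open RingDivisibility polyRing
  open import Algebra.Properties.Semiring.Exp semiring using (_^_)
  open import Algebra.Properties.Semiring.Mult semiring using (×-comm-*; ×-congʳ) renaming (_×_ to _·_)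
  open import Relation.Binary.Reasoning.Setoid setoid

  -- The formal derivative, by Leibniz: (a + Xp)′ = p + Xp′.
  ∂ : Poly → Poly
  ∂ []      = []
  ∂ (a ∷ p) = p + (0# ∷ ∂ p)

  ∂-zero : ∀ p → p ≈ [] → ∂ p ≈ []
  ∂-zero []      _ = refl
  ∂-zero (a ∷ p) e = begin
    p + (0# ∷ ∂ p)   ≈⟨ +-cong p≈0 (∷-cong ≡.refl (∂-zero p p≈0)) ⟩
    [] + (0# ∷ [])   ≈⟨ 0∷[]≈[] ⟩
    []               ∎
    where
    p≈0 : p ≈ []
    p≈0 = mk λ k → at e (suc k)

  ∂-cong : ∀ {p q} → p ≈ q → ∂ p ≈ ∂ q
  ∂-cong {[]}    {q}     e = sym (∂-zero q (sym e))
  ∂-cong {a ∷ p} {[]}    e = ∂-zero (a ∷ p) e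
  ∂-cong {a ∷ p} {b ∷ q} e = +-cong p≈q (∷-cong ≡.refl (∂-cong p≈q))
    where
    p≈q : p ≈ q
    p≈q = mk λ k → at e (suc k)

  ∂-∷ : ∀ a p → ∂ (a ∷ p) ≈ p + X * ∂ p
  ∂-∷ a p = +-congˡ {p} (sym (X* (∂ p)))

  ∂-+ : ∀ p q → ∂ (p + q) ≈ ∂ p + ∂ q
  ∂-+ []      q       = refl
  ∂-+ (a ∷ p) []      = sym (+-identityʳ (∂ (a ∷ p)))
  ∂-+ (a ∷ p) (b ∷ q) = begin
    ∂ (a K.+ b ∷ p + q)                  ≈⟨ ∂-∷ (a K.+ b) (p + q) ⟩
    p + q + X * ∂ (p + q)                ≈⟨ +-congˡ {p + q} (*-congˡ {X} (∂-+ p q)) ⟩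
    p + q + X * (∂ p + ∂ q)              ≈⟨ solve 5 (λ p q X dp dq → p :+ q :+ X :* (dp :+ dq) := (p :+ X :* dp) :+ (q :+ X :* dq)) refl p q X (∂ p) (∂ q) ⟩
    (p + X * ∂ p) + (q + X * ∂ q)        ≈⟨ +-cong (∂-∷ a p) (∂-∷ b q) ⟨
    ∂ (a ∷ p) + ∂ (b ∷ q)                ∎

  ∂-· : ∀ c p → ∂ (c ·ₚ p) ≈ c ·ₚ ∂ p
  ∂-· c []      = refl
  ∂-· c (a ∷ p) = begin
    c ·ₚ p + (0# ∷ ∂ (c ·ₚ p))           ≈⟨ +-congˡ {c ·ₚ p} (∷-cong (≡.sym (K.zeroʳ c)) (∂-· c p)) ⟩
    c ·ₚ p + c ·ₚ (0# ∷ ∂ p)             ≈⟨ ·-distribˡ-+ c p (0# ∷ ∂ p) ⟨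
    c ·ₚ (p + (0# ∷ ∂ p))                ∎

  ∂-* : ∀ p q → ∂ (p * q) ≈ ∂ p * q + p * ∂ q
  ∂-* []      q = refl
  ∂-* (a ∷ p) q = begin
    ∂ (a ·ₚ q + (0# ∷ p * q))                            ≈⟨ ∂-+ (a ·ₚ q) (0# ∷ p * q) ⟩
    ∂ (a ·ₚ q) + ∂ (0# ∷ p * q)                          ≈⟨ +-cong (trans (∂-· a q) (sym (const-* a (∂ q)))) (∂-∷ 0# (p * q)) ⟩
    constₚ a * ∂ q + (p * q + X * ∂ (p * q))             ≈⟨ +-congˡ {constₚ a * ∂ q} (+-congˡ {p * q} (*-congˡ {X} (∂-* p q))) ⟩
    constₚ a * ∂ q + (p * q + X * (∂ p * q + p * ∂ q))   ≈⟨ solve 6 (λ A X p q dp dq → A :* dq :+ (p :* q :+ X :* (dp :* q :+ p :* dq)) := (p :+ X :* dp) :* q :+ (A :+ X :* p) :* dq) refl (constₚ a) X p q (∂ p) (∂ q) ⟩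
    (p + X * ∂ p) * q + (constₚ a + X * p) * ∂ q         ≈⟨ +-cong (*-congʳ {q} (∂-∷ a p)) (*-congʳ {∂ q} (∷-split a p)) ⟨
    ∂ (a ∷ p) * q + (a ∷ p) * ∂ q                        ∎

  ∂-neg : ∀ p → ∂ (- p) ≈ - ∂ p
  ∂-neg p = begin
    ∂ (- p)                         ≈⟨ solve 2 (λ a b → a := (b :+ a) :- b) refl (∂ (- p)) (∂ p) ⟩
    (∂ p + ∂ (- p)) - ∂ p           ≈⟨ +-congʳ { - ∂ p} (trans (sym (∂-+ p (- p))) (∂-cong (-‿inverseʳ p))) ⟩
    - ∂ p                           ∎

  ∂-^ : ∀ n p → ∂ (p ^ suc n) ≈ suc n · (p ^ n * ∂ p)
  ∂-^ n p = trans (∂-* p (p ^ n)) (+-cong (*-comm (∂ p) (p ^ n)) (rest n))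
    where
    rest : ∀ n → p * ∂ (p ^ n) ≈ n · (p ^ n * ∂ p)
    rest zero    = trans (*-congˡ {p} 0∷[]≈[]) (zeroʳ p)
    rest (suc n) = begin
      p * ∂ (p ^ suc n)                  ≈⟨ *-congˡ {p} (∂-^ n p) ⟩
      p * (suc n · (p ^ n * ∂ p))        ≈⟨ ×-comm-* (suc n) p (p ^ n * ∂ p) ⟩
      suc n · (p * (p ^ n * ∂ p))        ≈⟨ ×-congʳ (suc n) (sym (*-assoc p (p ^ n) (∂ p))) ⟩
      suc n · (p ^ suc n * ∂ p)          ∎

  order·≈0 : ∀ p → order · p ≈ []
  order·≈0 p = mk λ k → ≡.trans (coeff-mult order k) (≡.trans
    (≡.cong (order KMult.×_) (≡.sym (K.*-identityˡ (coeff p k)))) (≡.trans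
    (≡.sym (KMult.×-assoc-* order 1# (coeff p k))) (≡.trans (≡.cong (K._* coeff p k) order·1≡0) (K.zeroˡ _))))
    where
    coeff-mult : ∀ n k → coeff (n · p) k ≡ n KMult.× coeff p k
    coeff-mult zero    k = ≡.refl
    coeff-mult (suc n) k = ≡.trans (coeff-+ p (n · p) k) (≡.cong (coeff p k K.+_) (coeff-mult n k))

  -- By `∂-^` this derivative is a q-fold multiple. The exponent is generalised to `n` so that it
  -- can be matched as a successor.
  ∂-^order : ∀ p → ∂ (p ^ order) ≈ []
  ∂-^order p = go order ≡.refl
    where
    go : ∀ n → n ≡ order → ∂ (p ^ n) ≈ []
    go zero    _ = 0∷[]≈[]
    go (suc n) e = trans (∂-^ n p) (trans (reflexive (≡.cong (_· (p ^ n * ∂ p)) e)) (order·≈0 _))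

  frobDiff : ℕ → Poly
  frobDiff d = frob d X - X

  private
    monic-^ : ∀ {d p} n → Monic d p → Monic (n ℕ.* d) (p ^ n)
    monic-^         zero    _  = ≡.refl , λ { zero () ; (suc k) _ → ≡.refl }
    monic-^ {d} {p} (suc n) mp = monic-* {p = p} {p ^ n} mp (monic-^ {p = p} n mp)

    monic-frob : ∀ d → Monic (order ℕ.^ d) (frob d X)
    monic-frob zero    = ≡.refl , λ { zero () ; (suc zero) (s≤s ()) ; (suc (suc k)) _ → ≡.refl }
    monic-frob (suc d) = monic-^ {p = frob d X} order (monic-frob d)

    2*order^≤ : ∀ d → order ℕ.^ d ℕ.+ order ℕ.^ d ℕ.≤ order ℕ.^ suc d
    2*order^≤ d = ℕ.≤-trans (ℕ.≤-reflexive (≡.cong (order ℕ.^ d ℕ.+_) (≡.sym (ℕ.+-identityʳ _))))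
                            (ℕ.*-monoˡ-≤ (order ℕ.^ d) 2≤order)

  monic-frobDiff : ∀ d → Monic (order ℕ.^ suc d) (frobDiff (suc d))
  monic-frobDiff d with monic-frob (suc d)
  ... | l , deg =
    ≡.trans (coeff-+ (frob (suc d) X) (- X) (order ℕ.^ suc d))
      (≡.trans (≡.cong₂ K._+_ l (Deg<-neg {p = X} X-deg _ ℕ.≤-refl)) (K.+-identityʳ 1#)) ,
    Deg<-+ {p = frob (suc d) X} deg (λ k le → Deg<-neg {p = X} X-deg k (ℕ.<⇒≤ le))
    where
    2≤ : 2 ℕ.≤ order ℕ.^ suc d
    2≤ = ℕ.≤-trans (ℕ.+-mono-≤ (ℕ.m^n>0 order d) (ℕ.m^n>0 order d)) (2*order^≤ d)
    X-deg : Deg< (order ℕ.^ suc d) X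
    X-deg (suc (suc k)) _ = ≡.refl
    X-deg zero          le = ⊥-elim (ℕ.<⇒≱ (ℕ.<-≤-trans (s≤s z≤n) 2≤) le)
    X-deg (suc zero)    le = ⊥-elim (ℕ.<⇒≱ 2≤ le)

  ∂-frobDiff : ∀ d → ∂ (frobDiff (suc d)) ≈ - constₚ 1#
  ∂-frobDiff d = begin
    ∂ (frob d X ^ order - X)               ≈⟨ ∂-+ (frob d X ^ order) (- X) ⟩
    ∂ (frob d X ^ order) + ∂ (- X)         ≈⟨ +-cong (∂-^order (frob d X)) (∂-neg X) ⟩
    - ∂ X                                  ≈⟨ -‿cong (mk λ { zero → K.+-identityʳ 1# ; (suc zero) → ≡.refl ; (suc (suc k)) → ≡.refl }) ⟩
    - constₚ 1#                            ∎

  -- If Q² divides X^(q^(d+1)) - X, then Q divides its derivative, which is -1.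
  frobDiff-squareFree : ∀ d → SquareFree (frobDiff (suc d))
  frobDiff-squareFree d Q mQ (h , hQQ≈f) = ∤const1 mQ (∣-respʳ
    (solve 1 (λ e → :- (:- e) := e) refl (constₚ 1#)) (∣-neg {Q} (∂ h * Q + h * (∂ Q + ∂ Q) , (begin
      (∂ h * Q + h * (∂ Q + ∂ Q)) * Q              ≈⟨ solve 4 (λ h dh Q dQ → (dh :* Q :+ h :* (dQ :+ dQ)) :* Q := dh :* (Q :* Q) :+ h :* (dQ :* Q :+ Q :* dQ)) refl h (∂ h) Q (∂ Q) ⟩
      ∂ h * (Q * Q) + h * (∂ Q * Q + Q * ∂ Q)      ≈⟨ +-congˡ {∂ h * (Q * Q)} (*-congˡ {h} (∂-* Q Q)) ⟨
      ∂ h * (Q * Q) + h * ∂ (Q * Q)                ≈⟨ ∂-* h (Q * Q) ⟨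
      ∂ (h * (Q * Q))                              ≈⟨ ∂-cong hQQ≈f ⟩
      ∂ (frobDiff (suc d))                         ≈⟨ ∂-frobDiff d ⟩
      - constₚ 1#                                  ∎))))

  private
    frobDiffProduct : ℕ → Poly
    frobDiffProduct zero    = constₚ 1#
    frobDiffProduct (suc m) = frobDiff (suc m) * frobDiffProduct m

    -- The degree q + q² + ⋯ + q^m stays below q^(m+1): the next sum is less than 2q^(m+1), which is
    -- at most q^(m+2).
    monic-frobDiffProduct : ∀ m → ∃ λ e → Monic e (frobDiffProduct m) × e ℕ.< order ℕ.^ suc m
    monic-frobDiffProduct zero    = 0 , (≡.refl , λ { zero () ; (suc k) _ → ≡.refl }) , ℕ.m^n>0 order 1
    monic-frobDiffProduct (suc m) with monic-frobDiffProduct m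
    ... | e , me , e< = order ℕ.^ suc m ℕ.+ e , monic-* {p = frobDiff (suc m)} {frobDiffProduct m} (monic-frobDiff m) me ,
      ℕ.<-≤-trans (ℕ.+-monoʳ-< (order ℕ.^ suc m) e<) (2*order^≤ (suc m))

    frobDiff∣product : ∀ {d} m → d ℕ.< m → frobDiff (suc d) ∣ frobDiffProduct m
    frobDiff∣product {d} (suc m) (s≤s d≤m) with ℕ.m≤n⇒m<n∨m≡n d≤m
    ... | inj₁ d<m    = x∣ʳy⇒x∣ʳzy (frobDiff (suc m)) (frobDiff∣product m d<m)
    ... | inj₂ ≡.refl = frobDiffProduct m , *-comm (frobDiffProduct m) (frobDiff (suc m))

  -- In F[X]/(P) the element X has exact period n = suc m under Frobenius: X^(q^n) − X is square-free
  -- and of larger degree than the product of the X^(q^d) − X with 1 ≤ d < n.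
  periodicFactor : ∀ m → ∃₂ λ e P → Monic (suc e) P × Maximal P × P ∣ frobDiff (suc m) ×
                   (∀ d → d ℕ.< m → ¬ P ∣ frobDiff (suc d))
  periodicFactor m with monic-frobDiffProduct m
  ... | _ , me , e< with exclusiveFactor _ {frobDiff (suc m)} (monic-frobDiff m) (frobDiff-squareFree m) {g = frobDiffProduct m} me e<
  ...   | e , P , mP , maximal , P∣f , P∤g =
    e , P , mP , maximal , P∣f , λ d d<m P∣fd → P∤g (∣ʳ-trans P∣fd (frobDiff∣product m d<m))

-- The field F[X]/(P) and its norm form

module QuotientRing (R : CommutativeRing 0ℓ 0ℓ) (P : CommutativeRing.Carrier R) where
  open CommutativeRing R
  open IntegerSolver R
  open RingDivisibility R

  infix 4 _≈ᴾ_
  record _≈ᴾ_ (a b : Carrier) : Set where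
    constructor mod
    field difference : P ∣ a - b
  open _≈ᴾ_ public

  ≈⇒≈ᴾ : ∀ {a b} → a ≈ b → a ≈ᴾ b
  ≈⇒≈ᴾ {a} {b} e = mod (∣-respʳ (sym (trans (+-congʳ e) (-‿inverseʳ b))) (P ∣0))

  quotientRing : CommutativeRing 0ℓ 0ℓ
  quotientRing = record
    { Carrier = Carrier ; _≈_ = _≈ᴾ_ ; _+_ = _+_ ; _*_ = _*_ ; -_ = -_ ; 0# = 0# ; 1# = 1#
    ; isCommutativeRing = record
      { isRing = record
        { +-isAbelianGroup = record
          { isGroup = record
            { isMonoid = record
              { isSemigroup = record
                { isMagma = record
                  { isEquivalence = record
                    { refl = ≈⇒≈ᴾ refl
                    ; sym = λ {a} {b} (mod e) → mod (∣-respʳ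
                        (solve 2 (λ a b → :- (a :- b) := b :- a) refl a b) (∣-neg e))
                    ; trans = λ {a} {b} {c} (mod e) (mod e′) → mod (∣-respʳ
                        (solve 3 (λ a b c → (a :- b) :+ (b :- c) := a :- c) refl a b c) (∣-+ e e′)) }
                  ; ∙-cong = λ {a} {b} {c} {d} (mod e) (mod e′) → mod (∣-respʳ
                      (solve 4 (λ a b c d → (a :- b) :+ (c :- d) := (a :+ c) :- (b :+ d)) refl a b c d) (∣-+ e e′)) }
                ; assoc = λ a b c → ≈⇒≈ᴾ (+-assoc a b c) }
              ; identity = (λ a → ≈⇒≈ᴾ (+-identityˡ a)) , λ a → ≈⇒≈ᴾ (+-identityʳ a) }
            ; inverse = (λ a → ≈⇒≈ᴾ (-‿inverseˡ a)) , λ a → ≈⇒≈ᴾ (-‿inverseʳ a)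
            ; ⁻¹-cong = λ {a} {b} (mod e) → mod (∣-respʳ
                (solve 2 (λ a b → :- (a :- b) := (:- a) :- (:- b)) refl a b) (∣-neg e)) }
          ; comm = λ a b → ≈⇒≈ᴾ (+-comm a b) }
        ; *-cong = λ {a} {b} {c} {d} (mod e) (mod e′) → mod (∣-respʳ
            (solve 4 (λ a b c d → c :* (a :- b) :+ b :* (c :- d) := a :* c :- b :* d) refl a b c d)
            (∣-+ (x∣ʳy⇒x∣ʳzy c e) (x∣ʳy⇒x∣ʳzy b e′)))
        ; *-assoc = λ a b c → ≈⇒≈ᴾ (*-assoc a b c)
        ; *-identity = (λ a → ≈⇒≈ᴾ (*-identityˡ a)) , λ a → ≈⇒≈ᴾ (*-identityʳ a)
        ; distrib = (λ a b c → ≈⇒≈ᴾ (distribˡ a b c)) , λ a b c → ≈⇒≈ᴾ (distribʳ a b c) }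
      ; *-comm = λ a b → ≈⇒≈ᴾ (*-comm a b) } }

module NormForm (F : FiniteField) (m e₀ : ℕ) (P : PolynomialRing.Poly F)
  (mP : PolynomialDivision.Monic F (suc e₀) P) (maximal : PolynomialDivision.Maximal F P)
  (P∣frobDiff : RingDivisibility._∣_ (PolynomialRing.polyRing F) P (PeriodicFactor.frobDiff F (suc m)))
  (P∤frobDiff : ∀ d → d ℕ.< m →
     ¬ RingDivisibility._∣_ (PolynomialRing.polyRing F) P (PeriodicFactor.frobDiff F (suc d)))
  where
  open FieldProperties F
  open PolynomialRing F
  open PolynomialDivision F using (Deg<; Monic; divMod; small-multiple≈0; Deg<-+; Deg<-·; Deg<-neg; Deg<-const; ∤const1; toList-deg; Lead; zeroOrLead; lead-<)
  open RingDivisibility polyRing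
  private
    module K = CommutativeRing fieldRing
    module KPoly = PolynomialFunctions fieldRing
    module FX = CommutativeRing polyRing
    module FXSolver = IntegerSolver polyRing
    module FXExp = Algebra.Properties.Semiring.Exp FX.semiring
    module FXFrobenius = Frobenius F polyRing constₚ constₚ-isRingHomomorphism

  n : ℕ
  n = suc m

  open QuotientRing polyRing P
  open CommutativeRing quotientRing
  open import Algebra.Properties.Semiring.Exp semiring using (_^_)
  open import Relation.Binary.Reasoning.Setoid setoid

  constₚ-isRingHomomorphismᴾ : IsRingHomomorphism K.rawRing rawRing constₚ
  constₚ-isRingHomomorphismᴾ = record
    { isSemiringHomomorphism = record
      { isNearSemiringHomomorphism = record
        { +-isMonoidHomomorphism = record
          { isMagmaHomomorphism = record
            { isRelHomomorphism = record { cong = λ a≡b → ≈⇒≈ᴾ (C.⟦⟧-cong a≡b) }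
            ; homo = λ a b → ≈⇒≈ᴾ (C.+-homo a b) }
          ; ε-homo = ≈⇒≈ᴾ C.0#-homo }
        ; *-homo = λ a b → ≈⇒≈ᴾ (C.*-homo a b) }
      ; 1#-homo = ≈⇒≈ᴾ C.1#-homo }
    ; -‿homo = λ a → ≈⇒≈ᴾ (C.-‿homo a) }
    where module C = IsRingHomomorphism constₚ-isRingHomomorphism

  open PolynomialFunctions quotientRing
  open Frobenius F quotientRing constₚ constₚ-isRingHomomorphismᴾ

  ≈0⇒∣ : ∀ {a} → a ≈ 0# → P ∣ a
  ≈0⇒∣ {a} (mod e) = ∣-respʳ (FX.+-identityʳ a) e

  ∣⇒≈0 : ∀ {a} → P ∣ a → a ≈ 0#
  ∣⇒≈0 {a} e = mod (∣-respʳ (FX.sym (FX.+-identityʳ a)) e)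

  zeroOrUnit : ∀ a → a ≈ 0# ⊎ ∃ λ u → u * a ≈ 1#
  zeroOrUnit a with maximal a
  ... | inj₁ P∣a     = inj₁ (∣⇒≈0 P∣a)
  ... | inj₂ (u , e) = inj₂ (u , mod e)

  open Discrete zeroOrUnit (λ 1≈0 → ∤const1 mP (≈0⇒∣ 1≈0))

  -- The two Frobenius maps are built from powers in different rings on the same carrier.
  frob≡ : ∀ j a → frob j a ≡ FXFrobenius.frob j a
  frob≡ zero    a = ≡.refl
  frob≡ (suc j) a = ≡.trans (^≡ (FiniteField.order F)) (≡.cong (FXExp._^ FiniteField.order F) (frob≡ j a))
    where
    ^≡ : ∀ n {a} → a ^ n ≡ a FXExp.^ n
    ^≡ zero        = ≡.refl
    ^≡ (suc n) {a} = ≡.cong (a FX.*_) (^≡ n)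

  frob-X : frob n X ≈ X
  frob-X = mod (≡.subst (λ a → P ∣ a - X) (≡.sym (frob≡ n X)) P∣frobDiff)

  frob-X≉X : ∀ {d} → d ℕ.< m → ¬ frob (suc d) X ≈ X
  frob-X≉X {d} d<m (mod e) = P∤frobDiff d d<m (≡.subst (λ a → P ∣ a - X) (frob≡ (suc d) X) e)

  evaluate : Poly → Carrier → Carrier
  evaluate []      y = 0#
  evaluate (a ∷ p) y = y * evaluate p y + constₚ a

  evaluate-cong : ∀ p {y z} → y ≈ z → evaluate p y ≈ evaluate p z
  evaluate-cong []      e = refl
  evaluate-cong (a ∷ p) e = +-congʳ {constₚ a} (*-cong e (evaluate-cong p e))

  evaluate-zero : ∀ p y → p ≈ₚ [] → evaluate p y ≈ 0#
  evaluate-zero []      y e = refl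
  evaluate-zero (a ∷ p) y e = begin
    y * evaluate p y + constₚ a   ≈⟨ +-cong (*-congˡ {y} (evaluate-zero p y (mk λ k → at e (suc k)))) (≈⇒≈ᴾ (mk λ { zero → at e 0 ; (suc k) → ≡.refl })) ⟩
    y * 0# + 0#                   ≈⟨ trans (+-identityʳ (y * 0#)) (zeroʳ y) ⟩
    0#                            ∎

  evaluate-isPoly : ∀ {u d} p → Lead u d p → IsPoly (constₚ u) d (evaluate p)
  evaluate-isPoly {d = zero}  []      (≡.refl , _) = constant λ y → sym ι-0
  evaluate-isPoly {d = suc d} []      (≡.refl , _) =
    horner (λ _ → 0#) 0# (evaluate-isPoly {d = d} [] (≡.refl , λ _ _ → ≡.refl)) λ y → sym (trans (+-identityʳ (y * 0#)) (zeroʳ y))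
  evaluate-isPoly {d = zero}  (a ∷ p) (≡.refl , deg) = constant λ y →
    trans (+-congʳ {constₚ a} (trans (*-congˡ {y} (evaluate-zero p y (mk λ k → deg (suc k) (s≤s z≤n)))) (zeroʳ y)))
          (+-identityˡ (constₚ a))
  evaluate-isPoly {d = suc d} (a ∷ p) (l , deg) =
    horner (evaluate p) (constₚ a) (evaluate-isPoly p (l , λ k le → deg (suc k) (s≤s le))) λ _ → refl

  -- Frobenius fixes the coefficients of p, so p(X^(q^j)) = p(X)^(q^j). For j = 0 this says that
  -- p(X) is the residue class of p itself.
  evaluate-frob-X : ∀ j p → evaluate p (frob j X) ≈ frob j p
  evaluate-frob-X j []      = sym (frob-0 j)
  evaluate-frob-X j (a ∷ p) = begin
    frob j X * evaluate p (frob j X) + constₚ a   ≈⟨ +-cong (*-congˡ {frob j X} (evaluate-frob-X j p)) (sym (frob-ι j a)) ⟩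
    frob j X * frob j p + frob j (constₚ a)       ≈⟨ +-congʳ {frob j (constₚ a)} (frob-* j X p) ⟨
    frob j (X * p) + frob j (constₚ a)            ≈⟨ frob-+ j (X * p) (constₚ a) ⟨
    frob j (X * p + constₚ a)                     ≈⟨ frob-cong j (≈⇒≈ᴾ (FX.trans (∷-split a p) (FX.+-comm (constₚ a) (X * p)))) ⟨
    frob j (a ∷ p)                                ∎

  -- Every residue is a polynomial in X, so the period of X is a period of all of F[X]/(P).
  frob-fixed : ∀ p → frob n p ≈ p
  frob-fixed p = begin
    frob n p               ≈⟨ evaluate-frob-X n p ⟨
    evaluate p (frob n X)  ≈⟨ evaluate-cong p frob-X ⟩
    evaluate p X           ≈⟨ evaluate-frob-X 0 p ⟩
    p                      ∎

  -- A polynomial vanishing mod P vanishes at the n distinct conjugates of X.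
  small-nonzero : ∀ {p} → Deg< n p → ¬ p ≈ₚ [] → ¬ p ≈ 0#
  small-nonzero {p} deg p≉0 p≈0 with zeroOrLead p
  ... | inj₁ p≈[] = p≉0 p≈[]
  ... | inj₂ (u , d , u≢0 , l) = u≢0 (at (small-multiple≈0 mP (Deg<-const u (s≤s z≤n)) (≈0⇒∣ lead≈0)) 0)
    where
    conjugates : List Carrier
    conjugates = List.applyUpTo (λ j → frob j X) n
    distinct : ∀ {i j} → i ℕ.< j → j ℕ.< n → Separated (frob i X) (frob j X)
    distinct {i} i<j (s≤s j≤m) with ℕ.m≤n⇒∃[o]m+o≡n i<j
    -- Here j = i + (k + 1). If the conjugates i and j agreed, injectivity of Frobenius would give X
    -- a period k + 1 < n.
    ... | k , ≡.refl = ≉⇒separated λ e → frob-X≉X (ℕ.≤-trans (s≤s (ℕ.m≤n+m k i)) j≤m)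
      (frob-order {i = i} {suc k} (trans e (reflexive (≡.cong (λ l → frob l X) (≡.sym (ℕ.+-suc i k))))))
    roots : All (λ c → evaluate p c ≈ 0#) conjugates
    roots = All.applyUpTo⁺₂ (λ j → frob j X) n λ j → trans (evaluate-frob-X j p) (trans (frob-cong j p≈0) (frob-0 j))
    lead≈0 : constₚ u ≈ 0#
    lead≈0 = tooManyRoots⇒lead≈0 conjugates
      (≡.subst (d ℕ.<_) (≡.sym (List.length-applyUpTo (λ j → frob j X) n)) (lead-< {p = p} u≢0 l deg))
      (evaluate-isPoly p l) (AllPairs.applyUpTo⁺₁ (λ j → frob j X) n distinct) roots

  abstract
    remainder : Carrier → Poly
    remainder a = proj₁ (proj₂ (divMod {suc e₀} {P} mP a))

    remainder-small : ∀ a → Deg< (suc e₀) (remainder a)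
    remainder-small a = proj₂ (proj₂ (proj₂ (divMod {suc e₀} {P} mP a)))

    remainder-≈ : ∀ a → remainder a ≈ a
    remainder-≈ a with divMod {suc e₀} {P} mP a
    ... | q , r , a≈ , _ = mod (FX.- q , FX.trans
      (FXSolver.solve 3 (λ q P r → (:- q) :* P := r :- (q :* P :+ r)) FX.refl q P r)
      (FX.+-congˡ {r} (FX.-‿cong (FX.sym a≈))))
      where open FXSolver using (_:=_; _:*_; _:+_; _:-_; :-_)

  -- An F-linear retraction of F[X]/(P) onto F; composing with it makes polynomial functions over
  -- different quotients F[X]/(P) polynomial over F, so that they can be added.
  retract : Carrier → K.Carrier
  retract a = coeff (remainder a) 0

  -- Two representatives of degree below deg P differ by a small multiple of P, hence not at all.
  -- Linearity then reduces to adding and scaling remainders.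
  retract-unique : ∀ {a r} → Deg< (suc e₀) r → r ≈ a → retract a ≡ coeff r 0
  retract-unique {a} {r} deg r≈a = at (FX.trans
    (FXSolver.solve 2 (λ s r → s := (s :- r) :+ r) FX.refl (remainder a) r)
    (FX.+-congʳ {r} (small-multiple≈0 mP
      (Deg<-+ {p = remainder a} (remainder-small a) (Deg<-neg {p = r} deg))
      (difference (trans (remainder-≈ a) (sym r≈a)))))) 0
    where open FXSolver using (_:=_; _:+_; _:-_)

  retract-cong : ∀ {a b} → a ≈ b → retract a ≡ retract b
  retract-cong {a} {b} a≈b = retract-unique (remainder-small b) (trans (remainder-≈ b) (sym a≈b))

  retract-const : ∀ c → retract (constₚ c) ≡ c
  retract-const c = retract-unique {constₚ c} {constₚ c} (Deg<-const c (s≤s z≤n)) refl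

  retract-+ : ∀ a b → retract (a + b) ≡ retract a K.+ retract b
  retract-+ a b = ≡.trans
    (retract-unique (Deg<-+ {p = remainder a} (remainder-small a) (remainder-small b)) (+-cong (remainder-≈ a) (remainder-≈ b)))
    (coeff-+ (remainder a) (remainder b) 0)

  retract-* : ∀ c a → retract (constₚ c * a) ≡ c K.* retract a
  retract-* c a = ≡.trans
    (retract-unique (Deg<-· c (remainder a) (remainder-small a))
      (trans (≈⇒≈ᴾ (FX.sym (const-* c (remainder a)))) (*-congˡ {constₚ c} (remainder-≈ a))))
    (coeff-· c (remainder a) 0)

  -- At scalar arguments Horner's scheme uses only addition and multiplication by scalars, and
  -- `retract` respects both.
  isPoly-retract : ∀ {u d f} → IsPoly u d f → KPoly.IsPoly (retract u) d (λ x → retract (f (constₚ x)))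
  isPoly-retract (constant e) = KPoly.constant λ x → retract-cong (e (constₚ x))
  isPoly-retract (horner g b p e) = KPoly.horner (λ x → retract (g (constₚ x))) (retract b) (isPoly-retract p)
    λ x → ≡.trans (retract-cong (e (constₚ x))) (≡.trans (retract-+ (constₚ x * g (constₚ x)) b)
      (≡.cong (K._+ retract b) (retract-* x (g (constₚ x)))))

  toList-linePoint : ∀ {d} (a b : Vec K.Carrier d) x →
                     Vec.toList (linePoint F a b x) ≈ₚ constₚ x FX.* Vec.toList a FX.+ Vec.toList b
  toList-linePoint a b x = FX.trans (FX.reflexive (go a b))
    (FX.+-congʳ {Vec.toList b} (FX.sym (const-* x (Vec.toList a))))
    where
    go : ∀ {d} (a b : Vec K.Carrier d) → Vec.toList (linePoint F a b x) ≡ x ·ₚ Vec.toList a FX.+ Vec.toList b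
    go []      []      = ≡.refl
    go (_ ∷ a) (_ ∷ b) = ≡.cong (_ ∷_) (go a b)

  toList-nonzero : ∀ {d} (a : Vec K.Carrier d) → a ≢ zeroVec F d → ¬ Vec.toList a ≈ₚ []
  toList-nonzero a a≢0 e = a≢0 (go a e)
    where
    go : ∀ {d} (a : Vec K.Carrier d) → Vec.toList a ≈ₚ [] → a ≡ zeroVec F d
    go []      e = ≡.refl
    go (_ ∷ a) e = ≡.cong₂ _∷_ (at e 0) (go a (mk λ k → at e (suc k)))

  normForm : Vec K.Carrier n → K.Carrier
  normForm v = retract (norm n (Vec.toList v))

  -- The leading coefficient is the retracted norm of the direction. That norm is a nonzero scalar,
  -- and `retract` is the identity on scalars, so it does not vanish.
  normForm-onLine : ∀ a b → a ≢ zeroVec F n →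
                    ∃ λ u → u ≢ K.0# × KPoly.IsPoly u n (λ x → normForm (linePoint F a b x))
  normForm-onLine a b a≢0 = u , u≢0 , isPoly
    where
    A = Vec.toList a
    A≉0 : ¬ A ≈ 0#
    A≉0 = small-nonzero (toList-deg a) (toList-nonzero a a≢0)
    u = retract (norm n A)
    scalar : ∃ λ c → norm n A ≈ constₚ c
    scalar = norm-scalar n {A} (frob-fixed A) A≉0
    u≡ : u ≡ proj₁ scalar
    u≡ = ≡.trans (retract-cong (proj₂ scalar)) (retract-const (proj₁ scalar))
    u≢0 : u ≢ K.0#
    u≢0 u≡0 = norm-nonzero {A} A≉0 n (trans (proj₂ scalar)
      (trans (reflexive (≡.cong constₚ (≡.trans (≡.sym u≡) u≡0))) ι-0))
    line : ∃ λ f → IsPoly (norm n A) n f × (∀ c → f (constₚ c) ≈ norm n (constₚ c * A + Vec.toList b))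
    line = norm-onLine n A (Vec.toList b)
    onLine : ∀ x → proj₁ line (constₚ x) ≈ norm n (Vec.toList (linePoint F a b x))
    onLine x = trans (proj₂ (proj₂ line) x) (norm-cong n (≈⇒≈ᴾ (FX.sym (toList-linePoint a b x))))
    isPoly : KPoly.IsPoly u n (λ x → normForm (linePoint F a b x))
    isPoly = KPoly.isPoly-cong ≡.refl (λ x → retract-cong (onLine x)) (isPoly-retract (proj₁ (proj₂ line)))

private module ℕSolver = +-*-Solver

abstract
  normForm : (F : FiniteField) (m : ℕ) →
             ∃ λ (g : Vec (FiniteField.Carrier F) (suc m) → FiniteField.Carrier F) → ∀ a b → a ≢ zeroVec F (suc m) →
             ∃ λ u → u ≢ FiniteField.0# F ×
             PolynomialFunctions.IsPoly (FieldProperties.fieldRing F) u (suc m) (λ x → g (linePoint F a b x))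
  normForm F m with PeriodicFactor.periodicFactor F m
  ... | e , P , mP , maximal , P∣f , P∤f = N.normForm , N.normForm-onLine
    where module N = NormForm F m e P mP maximal P∣f P∤f

-- Evasive sets from graphs and products

module EvasiveSets (F : FiniteField) where
  open FiniteField F using (elements; elements-unique; order)
  open FieldProperties F
  open CommutativeRing fieldRing
  open IntegerSolver fieldRing
  open PolynomialFunctions fieldRing

  Line : ∀ {n} → Vec Carrier n → Vec Carrier n → Carrier → Vec Carrier n
  Line = linePoint F

  line-zeroDirection : ∀ {n} (b : Vec Carrier n) x → Line (zeroVec F n) b x ≡ b
  line-zeroDirection []      x = ≡.refl
  line-zeroDirection (b ∷ v) x = ≡.cong₂ _∷_ (≡.trans (≡.cong (_+ b) (zeroʳ x)) (+-identityˡ b)) (line-zeroDirection v x)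

  take-line : ∀ m {n} (a b : Vec Carrier (m ℕ.+ n)) x → Vec.take m (Line a b x) ≡ Line (Vec.take m a) (Vec.take m b) x
  take-line m a b x = ≡.trans (Vec.take-zipWith _+_ (Vec.map (x *_) a) b)
    (≡.cong (λ v → Vec.zipWith _+_ v (Vec.take m b)) (Vec.take-map (x *_) m a))

  drop-line : ∀ m {n} (a b : Vec Carrier (m ℕ.+ n)) x → Vec.drop m (Line a b x) ≡ Line (Vec.drop m a) (Vec.drop m b) x
  drop-line m a b x = ≡.trans (Vec.drop-zipWith {m = m} _+_ (Vec.map (x *_) a) b)
    (≡.cong (λ v → Vec.zipWith _+_ v (Vec.drop m b)) (Vec.drop-map (x *_) m a))

  zero-++ : ∀ m n → zeroVec F m Vec.++ zeroVec F n ≡ zeroVec F (m ℕ.+ n)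
  zero-++ zero    n = ≡.refl
  zero-++ (suc m) n = ≡.cong (0# ∷_) (zero-++ m n)

  take-drop-zero : ∀ m {n} (a : Vec Carrier (m ℕ.+ n)) → Vec.take m a ≡ zeroVec F m → Vec.drop m a ≡ zeroVec F n →
                   a ≡ zeroVec F (m ℕ.+ n)
  take-drop-zero m {n} a e e′ = ≡.trans (≡.sym (Vec.take++drop≡id m a))
    (≡.trans (≡.cong₂ Vec._++_ e e′) (zero-++ m n))

  -- The degree `d` may vary with the line. The bound `2 ≤ d` reserves degree 1 for the coordinate
  -- x₁, which enters only in `graph`.
  Mixed : ∀ (t r : ℕ) → (Vec Carrier r → Carrier) → Set
  Mixed t r G = ∀ a b → a ≢ zeroVec F r →
    ∃₂ λ d u → 2 ℕ.≤ d × d ℕ.≤ t × u ≢ 0# × IsPoly u d (λ x → G (Line a b x))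

  isPoly-zeroDirection : ∀ {r} (G : Vec Carrier r → Carrier) {a} b → a ≡ zeroVec F r → IsPoly (G b) 0 (λ x → G (Line a b x))
  isPoly-zeroDirection G b ≡.refl = constant λ x → ≡.cong G (line-zeroDirection b x)

  -- 2 + 3 + ⋯ + t, the number of coordinates other than x₁.
  blocks : ℕ → ℕ
  blocks zero          = 0
  blocks (suc zero)    = 0
  blocks (suc (suc t)) = suc (suc t) ℕ.+ blocks (suc t)

  mixed : ∀ t → ∃ (Mixed t (blocks t))
  mixed zero          = (λ _ → 0#) , λ { [] [] a≢0 → ⊥-elim (a≢0 ≡.refl) }
  mixed (suc zero)    = (λ _ → 0#) , λ { [] [] a≢0 → ⊥-elim (a≢0 ≡.refl) }
  mixed (suc (suc k)) with normForm F (suc k) | mixed (suc k)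
  ... | g , g-line | G , G-line = (λ v → g (Vec.take i v) + G (Vec.drop i v)) , sum-line
    where
    i = suc (suc k)
    r = blocks (suc k)
    sum-line : Mixed i (i ℕ.+ r) (λ v → g (Vec.take i v) + G (Vec.drop i v))
    sum-line a b a≢0 = cases (_≟ᵥ_ F a₁ (zeroVec F i)) (_≟ᵥ_ F a₂ (zeroVec F r))
      where
      a₁ = Vec.take i a
      a₂ = Vec.drop i a
      b₁ = Vec.take i b
      b₂ = Vec.drop i b
      onLine : ∀ x → g (Line a₁ b₁ x) + G (Line a₂ b₂ x) ≡ g (Vec.take i (Line a b x)) + G (Vec.drop i (Line a b x))
      onLine x = ≡.sym (≡.cong₂ (λ v w → g v + G w) (take-line i a b x) (drop-line i a b x))
      Result : Set
      Result = ∃₂ λ d u → 2 ℕ.≤ d × d ℕ.≤ i × u ≢ 0# × IsPoly u d (λ x → g (Vec.take i (Line a b x)) + G (Vec.drop i (Line a b x)))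
      top : a₁ ≢ zeroVec F i → IsPoly 0# i (λ x → G (Line a₂ b₂ x)) → Result
      top a₁≢0 q with g-line a₁ b₁ a₁≢0
      ... | u , u≢0 , p = i , u , s≤s (s≤s z≤n) , ℕ.≤-refl , u≢0 ,
        isPoly-cong (+-identityʳ u) onLine (isPoly-+ p q)
      cases : Dec (a₁ ≡ zeroVec F i) → Dec (a₂ ≡ zeroVec F r) → Result
      cases (yes a₁≡0) (yes a₂≡0) = ⊥-elim (a≢0 (take-drop-zero i a a₁≡0 a₂≡0))
      cases (no a₁≢0)  (yes a₂≡0) = top a₁≢0 (isPoly-lift (s≤s z≤n) (isPoly-zeroDirection G b₂ a₂≡0))
      cases (no a₁≢0)  (no a₂≢0) with G-line a₂ b₂ a₂≢0
      ... | d , u , 2≤d , d≤k , u≢0 , p = top a₁≢0 (isPoly-lift (s≤s d≤k) p)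
      cases (yes a₁≡0) (no a₂≢0) with G-line a₂ b₂ a₂≢0
      ... | d , u , 2≤d , d≤k , u≢0 , p = d , u , 2≤d , ℕ.m≤n⇒m≤1+n d≤k , u≢0 ,
        -- The direction vanishes on the first block, whose norm is therefore constant along the
        -- line and lies below degree `d`.
        isPoly-cong (+-identityˡ u) onLine
          (isPoly-+ (isPoly-lift (ℕ.<-≤-trans (s≤s z≤n) 2≤d) (isPoly-zeroDirection g b₁ a₁≡0)) p)

  roots-≤-degree : ∀ {u d f} {Q : Carrier → Set} (Q? : ∀ x → Dec (Q x)) → u ≢ 0# → IsPoly u d f →
                   (∀ {x} → Q x → f x ≡ 0#) → length (List.filter Q? elements) ℕ.≤ d
  roots-≤-degree Q? u≢0 p root = ℕ.≮⇒≥ λ d<length → u≢0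
    (tooManyRoots⇒lead≈0 (List.filter Q? elements) d<length p
      (AllPairs.map distinct⇒separated (Unique.filter⁺ Q? elements-unique))
      (All.map root (All.all-filter Q? elements)))

  record EvasiveSet (t n e : ℕ) : Set where
    field
      points  : List (Vec Carrier n)
      unique  : Unique points
      evasive : LineEvasive F t points
      size    : length points ≡ order ℕ.^ e

  -- If the direction has `v ≢ 0`, the term of degree `d ≥ 2` outweighs `x * a + b`. Otherwise `G`
  -- is constant on the line, `a` is nonzero, and there is at most one root, whence `1 ≤ t`.
  graph : ∀ {t r} G → 1 ℕ.≤ t → Mixed t r G → EvasiveSet t (suc r) r
  graph {t} {r} G 1≤t G-line = record
    { points = List.map point (vectors r) ; unique = Unique.map⁺ Vec.∷-injectiveʳ (vectors-unique r)
    ; evasive = evasive ; size = ≡.trans (List.length-map point (vectors r)) (length-vectors r) }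
    where
    point : Vec Carrier r → Vec Carrier (suc r)
    point w = - G w ∷ w
    onGraph : ∀ {x w} → x ∷ w ∈ List.map point (vectors r) → x + G w ≡ 0#
    onGraph v∈ with ∈.∈-map⁻ point v∈
    ... | w , _ , ≡.refl = -‿inverseˡ (G w)
    evasive : LineEvasive F t (List.map point (vectors r))
    evasive (a ∷ v) (b ∷ w) a≢0 with _≟ᵥ_ F v (zeroVec F r)
    ... | no v≢0 = let d , u , 2≤d , d≤t , u≢0 , p = G-line v w v≢0 in
      ℕ.≤-trans (roots-≤-degree (λ x → _∈?_ F (Line (a ∷ v) (b ∷ w) x) (List.map point (vectors r))) u≢0
        (isPoly-cong (+-identityˡ u) (λ _ → ≡.refl) (isPoly-+ (isPoly-lift 2≤d linear) p)) onGraph) d≤t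
      where
      linear : IsPoly a 1 (λ x → x * a + b)
      linear = horner (λ _ → a) b (constant λ _ → ≡.refl) λ _ → ≡.refl
    ... | yes ≡.refl = ℕ.≤-trans (roots-≤-degree
        (λ x → _∈?_ F (Line (a ∷ zeroVec F r) (b ∷ w) x) (List.map point (vectors r)))
        (λ a≡0 → a≢0 (≡.cong (_∷ zeroVec F r) a≡0))
        (horner (λ _ → a) (b + G w) (constant λ _ → ≡.refl) λ x →
          ≡.trans (≡.cong (λ v → (x * a + b) + G v) (line-zeroDirection w x)) (+-assoc (x * a) b (G w)))
        onGraph) 1≤t

  -- The graph over F^0 is one point of F^1; it fills a coordinate left over when n is divided by s.
  evasive-point : ∀ {t} → 1 ℕ.≤ t → EvasiveSet t 1 0
  evasive-point 1≤t = graph (λ _ → 0#) 1≤t λ { [] [] a≢0 → ⊥-elim (a≢0 ≡.refl) }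

  evasive-empty : ∀ {t} → EvasiveSet t 0 0
  evasive-empty = record
    { points = [] ∷ [] ; unique = [] ∷ []
    ; evasive = λ { [] [] a≢0 → ⊥-elim (a≢0 ≡.refl) } ; size = ≡.refl }

  -- Intersections are counted by parameters `x`, so lines in spaces of different dimension can be
  -- compared directly, as projections to a factor require.
  evasive-mono : ∀ {m n} {K : List (Vec Carrier m)} {L : List (Vec Carrier n)} {a b a′ b′} →
                 (∀ {x} → Line a b x ∈ K → Line a′ b′ x ∈ L) →
                 lineIntersectionSize F a b K ℕ.≤ lineIntersectionSize F a′ b′ L
  evasive-mono {K = K} {L} {a} {b} {a′} {b′} K⇒L = length-mono-≤
    (filter⁺ (λ x → _∈?_ F (Line a b x) K) (λ x → _∈?_ F (Line a′ b′ x) L) (λ { ≡.refl → K⇒L }) (⊆-refl {x = elements}))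

  evasive-product : ∀ {t m n d e} → EvasiveSet t m d → EvasiveSet t n e → EvasiveSet t (m ℕ.+ n) (d ℕ.+ e)
  evasive-product {t} {m} {n} {d} {e} K′ L′ = record
    { points = List.cartesianProductWith Vec._++_ K L
    ; unique = Unique.cartesianProductWith⁺ Vec._++_ (Vec.++-injective _ _) K′.unique L′.unique
    ; evasive = evasive
    ; size = ≡.trans (length-cartesianProductWith Vec._++_ K L)
        (≡.trans (≡.cong₂ ℕ._*_ K′.size L′.size) (≡.sym (ℕ.^-distribˡ-+-* order d e))) }
    where
    module K′ = EvasiveSet K′
    module L′ = EvasiveSet L′
    K = K′.points
    L = L′.points
    members : ∀ {v} → v ∈ List.cartesianProductWith Vec._++_ K L → Vec.take m v ∈ K × Vec.drop m v ∈ L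
    members {v} v∈ with ∈.∈-cartesianProductWith⁻ Vec._++_ K L v∈
    ... | w , w′ , w∈K , w′∈L , v≡ with Vec.++-injective (Vec.take m v) w (≡.trans (Vec.take++drop≡id m v) v≡)
    ...   | take≡w , drop≡w′ = ≡.subst (_∈ K) (≡.sym take≡w) w∈K , ≡.subst (_∈ L) (≡.sym drop≡w′) w′∈L
    evasive : LineEvasive F t (List.cartesianProductWith Vec._++_ K L)
    evasive a b a≢0 with _≟ᵥ_ F (Vec.take m a) (zeroVec F m)
    ... | no a₁≢0 = ℕ.≤-trans
      (evasive-mono {a = a} {b} λ {x} v∈ → ≡.subst (_∈ K) (take-line m a b x) (proj₁ (members v∈)))
      (K′.evasive (Vec.take m a) (Vec.take m b) a₁≢0)
    ... | yes a₁≡0 = ℕ.≤-trans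
      (evasive-mono {a = a} {b} λ {x} v∈ → ≡.subst (_∈ L) (drop-line m a b x) (proj₂ (members v∈)))
      (L′.evasive (Vec.drop m a) (Vec.drop m b) (λ a₂≡0 → a≢0 (take-drop-zero m a a₁≡0 a₂≡0)))

  evasive-power : ∀ {t n e} → EvasiveSet t n e → ∀ k → EvasiveSet t (k ℕ.* n) (k ℕ.* e)
  evasive-power K zero    = evasive-empty
  evasive-power K (suc k) = evasive-product K (evasive-power K k)

  blocks-formula : ∀ t → suc t ℕ.* suc t ℕ.+ suc t ≡ 2 ℕ.* suc (blocks (suc t))
  blocks-formula zero    = ≡.refl
  blocks-formula (suc t) = ≡.trans
    (ℕSolver.solve 1 (λ t → (2+ t) ℕSolver.:* (2+ t) ℕSolver.:+ (2+ t) ℕSolver.:=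
      ((1+ t) ℕSolver.:* (1+ t) ℕSolver.:+ (1+ t)) ℕSolver.:+ ℕSolver.con 2 ℕSolver.:* (2+ t)) ≡.refl t)
    (≡.trans (≡.cong (ℕ._+ 2 ℕ.* suc (suc t)) (blocks-formula t))
    (ℕSolver.solve 2 (λ t r → ℕSolver.con 2 ℕSolver.:* (1+ r) ℕSolver.:+ ℕSolver.con 2 ℕSolver.:* (2+ t) ℕSolver.:=
      ℕSolver.con 2 ℕSolver.:* (1+ ((2+ t) ℕSolver.:+ r))) ≡.refl t (blocks (suc t))))
    where
    1+ 2+ : ∀ {n} → ℕSolver.Polynomial n → ℕSolver.Polynomial n
    1+ p = ℕSolver.con 1 ℕSolver.:+ p
    2+ p = ℕSolver.con 2 ℕSolver.:+ p

  -- For n = j + ks with s = `suc r`, the part ks · 2r equals kr · 2s, and the j leftover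
  -- coordinates lose at most s · 2r. The summand `j * 0` is the exponent contributed by j single
  -- points.
  exponents : ∀ r j k → j ℕ.≤ suc r →
              (j ℕ.+ k ℕ.* suc r) ℕ.* (2 ℕ.* suc r ℕ.∸ 2) ℕ.≤
              suc r ℕ.* (2 ℕ.* r) ℕ.+ (j ℕ.* 0 ℕ.+ k ℕ.* r) ℕ.* (2 ℕ.* suc r)
  exponents r j k j≤ = begin
    (j ℕ.+ k ℕ.* suc r) ℕ.* (2 ℕ.* suc r ℕ.∸ 2)
      ≡⟨ ≡.cong (λ m → (j ℕ.+ k ℕ.* suc r) ℕ.* m) (≡.cong (ℕ._∸ 1) (ℕ.+-suc r (r ℕ.+ 0))) ⟩
    (j ℕ.+ k ℕ.* suc r) ℕ.* (2 ℕ.* r)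
      ≡⟨ ℕ.*-distribʳ-+ (2 ℕ.* r) j (k ℕ.* suc r) ⟩
    j ℕ.* (2 ℕ.* r) ℕ.+ k ℕ.* suc r ℕ.* (2 ℕ.* r)
      ≤⟨ ℕ.+-monoˡ-≤ _ (ℕ.*-monoˡ-≤ (2 ℕ.* r) j≤) ⟩
    suc r ℕ.* (2 ℕ.* r) ℕ.+ k ℕ.* suc r ℕ.* (2 ℕ.* r)
      ≡⟨ ≡.cong (suc r ℕ.* (2 ℕ.* r) ℕ.+_) (ℕSolver.solve 3
           (λ r j k → k ℕSolver.:* (ℕSolver.con 1 ℕSolver.:+ r) ℕSolver.:* (ℕSolver.con 2 ℕSolver.:* r) ℕSolver.:=
             (j ℕSolver.:* ℕSolver.con 0 ℕSolver.:+ k ℕSolver.:* r) ℕSolver.:* (ℕSolver.con 2 ℕSolver.:* (ℕSolver.con 1 ℕSolver.:+ r)))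
           ≡.refl r j k) ⟩
    suc r ℕ.* (2 ℕ.* r) ℕ.+ (j ℕ.* 0 ℕ.+ k ℕ.* r) ℕ.* (2 ℕ.* suc r) ∎
    where open ℕ.≤-Reasoning

  -- Exponents are multiplied by 2s, which `blocks-formula` identifies with the power of `length K`,
  -- so that the bound stays in ℕ. Its 2s-th root says that the size of K falls short of q^(n(1 -
  -- 1/s)) by at most a factor q^(s-1).
  evasive-large : ∀ t n → Σ (List (Vec Carrier n)) λ K → Unique K × LineEvasive F (suc t) K ×
    order ℕ.^ (n ℕ.* (suc t ℕ.* suc t ℕ.+ suc t ℕ.∸ 2)) ℕ.≤
    order ℕ.^ (suc (blocks (suc t)) ℕ.* (2 ℕ.* blocks (suc t))) ℕ.* length K ℕ.^ (suc t ℕ.* suc t ℕ.+ suc t)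
  evasive-large t n = K.points , K.unique , K.evasive , (begin
    order ℕ.^ (n ℕ.* (suc t ℕ.* suc t ℕ.+ suc t ℕ.∸ 2))
      ≡⟨ ≡.cong₂ (λ n m → order ℕ.^ (n ℕ.* (m ℕ.∸ 2))) (m≡m%n+[m/n]*n n (suc r)) (blocks-formula t) ⟩
    order ℕ.^ ((j ℕ.+ k ℕ.* suc r) ℕ.* (2 ℕ.* suc r ℕ.∸ 2))
      ≤⟨ ℕ.^-monoʳ-≤ order (exponents r j k (m%n≤n n (suc r))) ⟩
    order ℕ.^ (suc r ℕ.* (2 ℕ.* r) ℕ.+ (j ℕ.* 0 ℕ.+ k ℕ.* r) ℕ.* (2 ℕ.* suc r))
      ≡⟨ ℕ.^-distribˡ-+-* order (suc r ℕ.* (2 ℕ.* r)) _ ⟩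
    order ℕ.^ (suc r ℕ.* (2 ℕ.* r)) ℕ.* order ℕ.^ ((j ℕ.* 0 ℕ.+ k ℕ.* r) ℕ.* (2 ℕ.* suc r))
      ≡⟨ ≡.cong (order ℕ.^ (suc r ℕ.* (2 ℕ.* r)) ℕ.*_) (≡.sym (ℕ.^-*-assoc order (j ℕ.* 0 ℕ.+ k ℕ.* r) (2 ℕ.* suc r))) ⟩
    order ℕ.^ (suc r ℕ.* (2 ℕ.* r)) ℕ.* (order ℕ.^ (j ℕ.* 0 ℕ.+ k ℕ.* r)) ℕ.^ (2 ℕ.* suc r)
      ≡⟨ ≡.cong₂ (λ l m → order ℕ.^ (suc r ℕ.* (2 ℕ.* r)) ℕ.* l ℕ.^ m) K.size (blocks-formula t) ⟨
    order ℕ.^ (suc r ℕ.* (2 ℕ.* r)) ℕ.* length K.points ℕ.^ (suc t ℕ.* suc t ℕ.+ suc t) ∎)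
    where
    open ℕ.≤-Reasoning
    r = blocks (suc t)
    j = n % suc r
    k = n / suc r
    K : EvasiveSet (suc t) n (j ℕ.* 0 ℕ.+ k ℕ.* r)
    K = ≡.subst (λ n → EvasiveSet (suc t) n (j ℕ.* 0 ℕ.+ k ℕ.* r))
      (≡.trans (≡.cong (ℕ._+ k ℕ.* suc r) (ℕ.*-identityʳ j)) (≡.sym (m≡m%n+[m/n]*n n (suc r))))
      (evasive-product (evasive-power (evasive-point (s≤s z≤n)) j)
                       (evasive-power (graph (proj₁ (mixed (suc t))) (s≤s z≤n) (proj₂ (mixed (suc t)))) k))
    module K = EvasiveSet K

open import Data.Nat using (_≤_; _<_; _*_; _+_; _∸_; _^_)

theorem1p1 : (F : FiniteField) → (t : ℕ) → 1 ≤ t → t < FiniteField.order F →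
    Σ ℕ λ d → 1 ≤ d × Σ ℕ λ N → (n : ℕ) → N ≤ n →
    Σ (List (Vec (FiniteField.Carrier F) n)) λ K →
    Unique K × LineEvasive F t K ×
    FiniteField.order F ^ (n * ((t * t + t) ∸ 2)) ≤ d * length K ^ (t * t + t)
-- The constant `q ^ c` depends only on q and t, and the threshold 0 means that the bound holds in
-- every dimension.
theorem1p1 F (suc t) _ _ = q ^ c , ℕ.m^n>0 q c , 0 , λ n _ → evasive-large t n
  where
  open FieldProperties F
  open EvasiveSets F
  q = FiniteField.order F
  c = suc (blocks (suc t)) * (2 * blocks (suc t))
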